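{- If $H$ is an edge-ordered $d$-degenerate graph on $n$ vertices, then $r_{\text{edge}}(H)\le n^{600d^3\log_2(d+1)}$.
   Context: An edge-ordered graph is a finite simple graph together with a total ordering of its edges (equivalently, an assignment of distinct integer labels to its edges). Two edge-ordered graphs are equivalent if there is a graph isomorphism between them preserving the ordering of the edges; a copy of $H$ in $G$ is a subgraph of $G$ (with inherited edge-ordering) equivalent to $H$. The edge-ordered Ramsey number $r_{\text{edge}}(H)$ is the smallest $N$ such that there exists an edge-ordered graph $G$ on $N$ vertices such that every two-coloring of the edges of $G$ contains a monochromatic copy of $H$. A graph is $d$-degenerate if every induced subgraph has a vertex of degree at most $d$.
   Formalization: The theorem is stated for d at least 1; for d = 0 the claimed bound is n^0 = 1, which fails for the edgeless graph on n ≥ 2 vertices, since any host graph must have at least n vertices. -}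

module Defs where

open import Data.Nat using (ℕ; zero; suc; _+_; _*_; _^_; _≤_; _<_)
open import Data.Fin using (Fin)
open import Data.Fin.Subset using (Subset; Nonempty; _∈_; _∩_; ∣_∣)
open import Data.Bool using (Bool; true; false)
open import Data.Vec using (tabulate)
open import Data.Product using (Σ; ∃; _×_; _,_)
open import Data.Sum using (_⊎_)
open import Relation.Binary.PropositionalEquality using (_≡_)
open import Function.Definitions using (Injective)

-- An edge-ordered graph on vertex set Fin n: a finite simple graph
-- (symmetric, irreflexive adjacency) with distinct natural-number labels
-- on its edges (the label of the edge {u,v} is label u v = label v u).
-- The edge ordering is the order of the labels.
record EOGraph (n : ℕ) : Set where
  field
    adj       : Fin n → Fin n → Bool
    adj-sym   : ∀ u v → adj u v ≡ adj v u
    adj-irr   : ∀ v → adj v v ≡ false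
    label     : Fin n → Fin n → ℕ
    label-sym : ∀ u v → label u v ≡ label v u
    label-inj : ∀ u v x y → adj u v ≡ true → adj x y ≡ true →
                label u v ≡ label x y → (u ≡ x × v ≡ y) ⊎ (u ≡ y × v ≡ x)

open EOGraph public

Edge : ∀ {n} → EOGraph n → Fin n → Fin n → Set
Edge G u v = adj G u v ≡ true

nbhd : ∀ {n} → EOGraph n → Fin n → Subset n
nbhd G v = tabulate (adj G v)

Degenerate : ∀ {n} → ℕ → EOGraph n → Set
Degenerate {n} d G =
  (S : Subset n) → Nonempty S → ∃ λ v → v ∈ S × ∣ S ∩ nbhd G v ∣ ≤ d

record Copy {n N : ℕ} (H : EOGraph n) (G : EOGraph N) : Set where
  field
    φ       : Fin n → Fin N
    φ-inj   : Injective _≡_ _≡_ φ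
    φ-edge  : ∀ u v → Edge H u v → Edge G (φ u) (φ v)
    φ-ord   : ∀ u v x y → Edge H u v → Edge H x y →
              label H u v < label H x y → label G (φ u) (φ v) < label G (φ x) (φ y)
    φ-ord⁻  : ∀ u v x y → Edge H u v → Edge H x y →
              label G (φ u) (φ v) < label G (φ x) (φ y) → label H u v < label H x y

open Copy public

record Colouring (N : ℕ) : Set where
  field
    col     : Fin N → Fin N → Bool
    col-sym : ∀ u v → col u v ≡ col v u

open Colouring public

MonoCopy : ∀ {n N} → EOGraph n → (G : EOGraph N) → Colouring N → Set
MonoCopy H G c = Σ (Copy H G) λ K → ∃ λ (b : Bool) →
  ∀ u v → Edge H u v → col c (φ K u) (φ K v) ≡ b

RamseyFor : ∀ {n N} → EOGraph n → EOGraph N → Set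
RamseyFor {N = N} H G = (c : Colouring N) → MonoCopy H G c

-- N witnesses an upper bound on r_edge(H): some edge-ordered graph on N
-- vertices is Ramsey for H.
RamseyWitness : ∀ {n} → EOGraph n → ℕ → Set
RamseyWitness H N = Σ (EOGraph N) λ G → RamseyFor H G

-- "N ≤ B^(a · log₂ m)" for naturals N, B, a and m ≥ 1, stated without reals:
-- for every rational p/q (q ≥ 1) with log₂ m ≤ p/q, i.e. m^q ≤ 2^p,
-- we have N^q ≤ B^(a·p).
BoundedByPowLog : ℕ → ℕ → ℕ → ℕ → Set
BoundedByPowLog N B a m =
  ∀ p q → 1 ≤ q → m ^ q ≤ 2 ^ p → N ^ q ≤ B ^ (a * p)

{-# OPTIONS --safe #-}
module Submission where

open import Defs
open import Data.Nat using (ℕ; _+_; _*_; _^_; _≤_)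
open import Data.Product using (∃; _×_)
open import Data.Nat using (zero; suc; _<_; z≤n; s≤s; s≤s⁻¹; _≤?_; _<?_; NonZero; >-nonZero; >-nonZero⁻¹)
open import Data.Nat.Properties
open import Data.Nat.Tactic.RingSolver using (solve-∀)
open import Data.Bool using (Bool; true; false; _∧_; _∨_; not; if_then_else_)
import Data.Bool.Properties as Bool
open import Data.Empty using (⊥; ⊥-elim)
open import Data.Fin using (Fin; zero; suc; toℕ; fromℕ<; combine; remQuot; finToFun; funToFin)
import Data.Fin.Properties as Fin
open import Data.Fin.Subset using (_∩_; ∣_∣)
open import Data.Product using (∃₂; _,_; proj₁; proj₂; uncurry)
open import Data.Sum using (_⊎_; inj₁; inj₂)
import Data.Vec as Vec
open import Data.Vec using (tabulate)
open import Data.Vec.Properties using (lookup∘tabulate; lookup⇒[]=; []=⇒lookup)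
open import Algebra.Properties.Semiring.Sum +-*-semiring using (sum; sum-cong-≗; ∑-distrib-+; ∑-comm; *-distribˡ-sum; *-distribʳ-sum)
open import Function using (_∘_)
open import Function.Bundles using (mk⇔)
open import Relation.Binary using (tri<; tri≈; tri>)
open import Relation.Binary.PropositionalEquality using (_≡_; _≢_; refl; sym; trans; cong; cong₂; subst; subst₂)
open import Relation.Nullary using (¬_; Dec; yes; no; does; contradiction; ¬?)
open import Relation.Nullary.Decidable using (_×-dec_; _→-dec_; does-⇔)

-- The host is a complete graph on N vertices whose edges carry labels f x y in an interval of length
-- M = n^(4d), chosen so that any two disjoint s-sets of vertices span an edge of every label; a union
-- bound shows that s = n^(17d) suffices. Ties between labels are broken arbitrarily. The labels are
-- organised as a tree of nested intervals with branching n², and the edge of H of rank i is to be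
-- embedded with a label in the i-th child of a given interval.
-- Fix a colouring. Embedding H greedily in red into a large set, in an order witnessing degeneracy,
-- either succeeds or gets stuck at large sets A, B such that every vertex of B has few red neighbours
-- in A with labels in one child interval. Repeating this inside B, and then inside the vertices of A
-- that have few red neighbours in all the sets found in B, each time passing to that child interval,
-- yields after h rounds 2^h > d sets and a single interval in which the red density between any two of
-- them is small. Now embed H in blue, one of these sets for each class of a proper colouring of H: if
-- this gets stuck at A, B, then some label is rare between A and B in both colours, contradicting the
-- choice of f.

-- Boolean-valued sets, counting and pigeonhole principles

∧-intro : ∀ {a b} → a ≡ true → b ≡ true → a ∧ b ≡ true
∧-intro refl refl = refl

∧-fst : ∀ {a b} → a ∧ b ≡ true → a ≡ true
∧-fst {true} _ = refl

∧-snd : ∀ {a b} → a ∧ b ≡ true → b ≡ true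
∧-snd {true} p = p

does-sound : ∀ {a} {P : Set a} (P? : Dec P) → does P? ≡ true → P
does-sound (yes p) _ = p

does-complete : ∀ {a} {P : Set a} (P? : Dec P) → P → does P? ≡ true
does-complete (yes _) _ = refl
does-complete (no ¬p) p = contradiction p ¬p

does-refute : ∀ {a} {P : Set a} (P? : Dec P) → ¬ P → does P? ≡ false
does-refute (yes p) ¬p = contradiction p ¬p
does-refute (no _) _ = refl

bit : Bool → ℕ
bit true  = 1
bit false = 0

infix 4 _⊑_

_⊑_ : ∀ {A : Set} → (A → Bool) → (A → Bool) → Set
P ⊑ Q = ∀ x → P x ≡ true → Q x ≡ true

-- Sizes of sets are sums of bits, so that every double count below is an exchange of two sums.
card : ∀ {n} → (Fin n → Bool) → ℕ
card P = sum (bit ∘ P)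

sum-mono : ∀ {n} {f g : Fin n → ℕ} → (∀ i → f i ≤ g i) → sum f ≤ sum g
sum-mono {zero}  le = z≤n
sum-mono {suc n} le = +-mono-≤ (le zero) (sum-mono (le ∘ suc))

sum-const : ∀ n c → sum {n} (λ _ → c) ≡ n * c
sum-const zero    c = refl
sum-const (suc n) c = cong (c +_) (sum-const n c)

term≤sum : ∀ {n} (f : Fin n → ℕ) i → f i ≤ sum f
term≤sum f zero    = m≤m+n _ _
term≤sum f (suc i) = m≤n⇒m≤o+n (f zero) (term≤sum (f ∘ suc) i)

bit-mono : ∀ {a b} → (a ≡ true → b ≡ true) → bit a ≤ bit b
bit-mono {false}     le = z≤n
bit-mono {true}  {b} le rewrite le refl = ≤-refl

card-mono : ∀ {n} {P Q : Fin n → Bool} → P ⊑ Q → card P ≤ card Q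
card-mono le = sum-mono (λ i → bit-mono (le i))

card-full : ∀ n → card {n} (λ _ → true) ≡ n
card-full n = trans (sum-const n 1) (*-identityʳ n)

card-nonempty : ∀ {n} (P : Fin n → Bool) → 1 ≤ card P → ∃ λ i → P i ≡ true
card-nonempty {suc n} P le with P zero in eq
... | true  = zero , eq
... | false with card-nonempty (P ∘ suc) le
...   | i , p = suc i , p

card-positive : ∀ {n} (P : Fin n → Bool) i → P i ≡ true → 1 ≤ card P
card-positive P i p = ≤-trans (≤-reflexive (cong bit (sym p))) (term≤sum (bit ∘ P) i)

card-∨ : ∀ {n} (P Q : Fin n → Bool) → card (λ i → P i ∨ Q i) ≤ card P + card Q
card-∨ P Q = begin
  card (λ i → P i ∨ Q i)               ≤⟨ sum-mono (λ i → bit-∨ (P i) (Q i)) ⟩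
  sum (λ i → bit (P i) + bit (Q i))    ≡⟨ ∑-distrib-+ (bit ∘ P) (bit ∘ Q) ⟩
  card P + card Q                      ∎
  where
  open ≤-Reasoning
  bit-∨ : ∀ a b → bit (a ∨ b) ≤ bit a + bit b
  bit-∨ true  b = s≤s z≤n
  bit-∨ false b = ≤-refl

card-split : ∀ {n} (P Q : Fin n → Bool) →
             card P ≤ card (λ i → P i ∧ Q i) + card (λ i → P i ∧ not (Q i))
card-split P Q = begin
  card P                                                 ≤⟨ sum-mono (λ i → bit-split (P i) (Q i)) ⟩
  sum (λ i → bit (P i ∧ Q i) + bit (P i ∧ not (Q i)))    ≡⟨ ∑-distrib-+ (λ i → bit (P i ∧ Q i)) _ ⟩
  card (λ i → P i ∧ Q i) + card (λ i → P i ∧ not (Q i))  ∎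
  where
  open ≤-Reasoning
  bit-split : ∀ a b → bit a ≤ bit (a ∧ b) + bit (a ∧ not b)
  bit-split true  true  = s≤s z≤n
  bit-split true  false = s≤s z≤n
  bit-split false b     = z≤n

card-subsingleton : ∀ {n} (P : Fin n → Bool) → (∀ i j → P i ≡ true → P j ≡ true → i ≡ j) → card P ≤ 1
card-subsingleton {zero}  P uniq = z≤n
card-subsingleton {suc n} P uniq with P zero in eq
... | false = card-subsingleton (P ∘ suc) (λ i j p q → Fin.suc-injective (uniq (suc i) (suc j) p q))
... | true  = s≤s (≮⇒≥ λ pos → absurd (card-nonempty (P ∘ suc) pos))
  where
  absurd : ∃ (λ i → P (suc i) ≡ true) → ⊥
  absurd (i , p) with uniq zero (suc i) eq p
  ... | ()

-- Double counting of the pairs (i , j) with rel i j.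
card-injection : ∀ {m n} (P : Fin m → Bool) (Q : Fin n → Bool) (rel : Fin m → Fin n → Bool) →
                 (∀ i → P i ≡ true → ∃ λ j → Q j ≡ true × rel i j ≡ true) →
                 (∀ i i′ j → rel i j ≡ true → rel i′ j ≡ true → i ≡ i′) →
                 card P ≤ card Q
card-injection {m} {n} P Q rel total inj = begin
  card P                                           ≤⟨ sum-mono out ⟩
  sum (λ i → sum (λ j → bit (Q j ∧ rel i j)))      ≡⟨ ∑-comm {m} {n} _ ⟩
  sum (λ j → sum (λ i → bit (Q j ∧ rel i j)))      ≤⟨ sum-mono into ⟩
  card Q                                           ∎
  where
  open ≤-Reasoning
  out : ∀ i → bit (P i) ≤ card (λ j → Q j ∧ rel i j)
  out i with P i in eq
  ... | false = z≤n
  ... | true  with total i eq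
  ...   | j , q , r = card-positive (λ j → Q j ∧ rel i j) j (∧-intro q r)
  into : ∀ j → card (λ i → Q j ∧ rel i j) ≤ bit (Q j)
  into j with Q j
  ... | false = ≤-reflexive (trans (sum-const m 0) (*-zeroʳ m))
  ... | true  = card-subsingleton (λ i → rel i j) (λ i i′ → inj i i′ j)

sum-pigeonhole : ∀ {n} (f : Fin n → ℕ) b → sum f < n * b → ∃ λ i → f i < b
sum-pigeonhole {n} f b lt with Fin.any? (λ i → f i <? b)
... | yes found = found
... | no  none  = contradiction
  (≤-trans (≤-reflexive (sym (sum-const n b))) (sum-mono (λ i → ≮⇒≥ λ lt′ → none (i , lt′))))
  (<⇒≱ lt)

-- By the covering, `card P` is at most the sum of all `card (Q j)`. If every `k * card (Q j)` were
-- below `card P`, summing over j would contradict this; nonemptiness of `P` gives k > 0, which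
-- keeps the summed inequality strict.
cover-pigeonhole : ∀ {n k} (P : Fin n → Bool) (Q : Fin k → Fin n → Bool) → 1 ≤ card P →
                   (∀ i → P i ≡ true → ∃ λ j → Q j i ≡ true) → ∃ λ j → card P ≤ k * card (Q j)
cover-pigeonhole {n} {k} P Q pos cov with Fin.any? (λ j → card P ≤? k * card (Q j))
... | yes found = found
... | no  none  = contradiction (*-monoʳ-≤ k total) (<⇒≱ scaled)
  where
  open ≤-Reasoning
  total : card P ≤ sum (λ j → card (Q j))
  total = begin
    card P                            ≤⟨ sum-mono (λ i → out i) ⟩
    sum (λ i → card (λ j → Q j i))    ≡⟨ ∑-comm {n} {k} (λ i j → bit (Q j i)) ⟩
    sum (λ j → card (Q j))            ∎
    where
    out : ∀ i → bit (P i) ≤ card (λ j → Q j i)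
    out i with P i in eq
    ... | false = z≤n
    ... | true  with cov i eq
    ...   | j , q = card-positive (λ j → Q j i) j q
  k>0 : 0 < k
  k>0 with card-nonempty P pos
  ... | i , p with cov i p
  ...   | j , _ = ≤-trans (s≤s z≤n) (Fin.toℕ<n j)
  less : ∀ {k} (f : Fin k → ℕ) b → 0 < k → (∀ j → f j < b) → sum f < k * b
  less {suc zero}    f b _ lt = +-mono-<-≤ (lt zero) z≤n
  less {suc (suc k)} f b _ lt = +-mono-< (lt zero) (less (f ∘ suc) b (s≤s z≤n) (lt ∘ suc))
  scaled : k * sum (λ j → card (Q j)) < k * card P
  scaled = begin-strict
    k * sum (λ j → card (Q j))    ≡⟨ *-distribˡ-sum k (λ j → card (Q j)) ⟩
    sum (λ j → k * card (Q j))    <⟨ less _ (card P) k>0 (λ j → ≰⇒> λ le → none (j , le)) ⟩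
    k * card P                    ∎

enumerate : ∀ {n} s (P : Fin n → Bool) → s ≤ card P →
            ∃ λ (g : Fin s → Fin n) → (∀ i j → g i ≡ g j → i ≡ j) × (∀ i → P (g i) ≡ true)
enumerate zero P le = (λ ()) , (λ ()) , (λ ())
enumerate {suc n} (suc s) P le with P zero in eq
... | false with enumerate (suc s) (P ∘ suc) le
...   | g , inj , mem = suc ∘ g , (λ i j e → inj i j (Fin.suc-injective e)) , mem
enumerate {suc n} (suc s) P le | true with enumerate s (P ∘ suc) (s≤s⁻¹ le)
...   | g , inj , mem = g′ , inj′ , mem′
  where
  g′ : Fin (suc s) → Fin (suc n)
  g′ zero    = zero
  g′ (suc i) = suc (g i)
  inj′ : ∀ i j → g′ i ≡ g′ j → i ≡ j
  inj′ zero    zero    e = refl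
  inj′ (suc i) (suc j) e = cong suc (inj i j (Fin.suc-injective e))
  mem′ : ∀ i → P (g′ i) ≡ true
  mem′ zero    = eq
  mem′ (suc i) = mem i

-- Derandomised union bound for labellings

-- weight a c is (1 + a)^e times the probability that a uniformly random
-- labelling of e points by 1 + a labels misses a prescribed label throughout c.
weight : ℕ → ∀ {e} → (Fin e → Bool) → ℕ
weight a {zero}  c = 1
weight a {suc e} c = (if c zero then a else suc a) * weight a (c ∘ suc)

hit : ∀ {m} → Bool → Fin m → Fin m → Bool
hit b l l′ = b ∧ does (l Fin.≟ l′)

-- Explains the factor in `weight`: of the 1 + a labels for a point, all but one leave a constraint
-- unmet if the point belongs to it, and all of them do otherwise.
sum-unhit : ∀ {a} (l : Fin (suc a)) b → sum (λ l′ → bit (not (hit b l l′))) ≡ (if b then a else suc a)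
sum-unhit {a} l false = card-full (suc a)
sum-unhit {a} l true  = missing l
  where
  missing : ∀ {a} (l : Fin (suc a)) → sum (λ l′ → bit (not (does (l Fin.≟ l′)))) ≡ a
  missing {a}     zero    = card-full a
  missing {suc a} (suc l) = cong suc (trans (sum-cong-≗ (λ l′ → cong (bit ∘ not) (shift l l′))) (missing l))
    where
    shift : ∀ {n} (i j : Fin n) → does (suc i Fin.≟ suc j) ≡ does (i Fin.≟ j)
    shift i j with i Fin.≟ j
    ... | yes _ = refl
    ... | no  _ = refl

bit-∧ : ∀ x y → bit (x ∧ y) ≡ bit x * bit y
bit-∧ true  y = sym (+-identityʳ (bit y))
bit-∧ false y = refl

-- Method of conditional expectations: the expected number of constraints (c t , L t) that are
-- active and violated is below one, and fixing labels one at a time keeps it so.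
hitting-labelling : ∀ a {e T} (act : Fin T → Bool) (c : Fin T → Fin e → Bool) (L : Fin T → Fin (suc a)) →
  sum (λ t → bit (act t) * weight a (c t)) < suc a ^ e →
  ∃ λ (f : Fin e → Fin (suc a)) → ∀ t → act t ≡ true → ∃ λ i → c t i ≡ true × f i ≡ L t
-- No point is left, so every weight is 1 and a single active constraint would bring the sum up to
-- (1 + a)^0 = 1.
hitting-labelling a {zero} {T} act c L small = (λ ()) , λ t active → contradiction
  (≤-trans (≤-trans (≤-reflexive (cong (λ b → bit b * 1) (sym active))) (term≤sum (λ t → bit (act t) * 1) t)) (s≤s⁻¹ small))
  (λ ())
hitting-labelling a {suc e} {T} act c L small = extend (sum-pigeonhole potential (suc a ^ e) averaged)
  where
  open ≤-Reasoning
  survives : Fin (suc a) → Fin T → Bool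
  survives l t = act t ∧ not (hit (c t zero) (L t) l)
  -- The scaled expectation once the first point has label l. By `column` these values add up to the
  -- previous expectation, which is below (1 + a) * (1 + a)^e, so some label has a value below (1 +
  -- a)^e.
  potential : Fin (suc a) → ℕ
  potential l = sum (λ t → bit (survives l t) * weight a (c t ∘ suc))
  rearrange : ∀ x y z → x * y * z ≡ x * z * y
  rearrange = solve-∀
  column : ∀ t → sum (λ l → bit (survives l t) * weight a (c t ∘ suc)) ≡ bit (act t) * weight a (c t)
  column t = begin-equality
    sum (λ l → bit (survives l t) * w)    ≡⟨ *-distribʳ-sum w (λ l → bit (survives l t)) ⟨
    sum (λ l → bit (survives l t)) * w    ≡⟨ cong (_* w) (sum-cong-≗ (λ l → bit-∧ (act t) (not (hit (c t zero) (L t) l)))) ⟩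
    sum (λ l → bit (act t) * bit (not (hit (c t zero) (L t) l))) * w
                                          ≡⟨ cong (_* w) (*-distribˡ-sum (bit (act t)) (λ l → bit (not (hit (c t zero) (L t) l)))) ⟨
    bit (act t) * sum (λ l → bit (not (hit (c t zero) (L t) l))) * w
                                          ≡⟨ cong (λ z → bit (act t) * z * w) (sum-unhit (L t) (c t zero)) ⟩
    bit (act t) * (if c t zero then a else suc a) * w
                                          ≡⟨ *-assoc (bit (act t)) _ w ⟩
    bit (act t) * weight a (c t)          ∎
    where w = weight a (c t ∘ suc)
  averaged : sum potential < suc a * suc a ^ e
  averaged = begin-strict
    sum potential                           ≡⟨ ∑-comm (λ l t → bit (survives l t) * weight a (c t ∘ suc)) ⟩
    sum (λ t → sum (λ l → bit (survives l t) * weight a (c t ∘ suc)))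
                                            ≡⟨ sum-cong-≗ column ⟩
    sum (λ t → bit (act t) * weight a (c t)) <⟨ small ⟩
    suc a * suc a ^ e                       ∎
  extend : (∃ λ l → potential l < suc a ^ e) →
           ∃ λ (f : Fin (suc e) → Fin (suc a)) → ∀ t → act t ≡ true → ∃ λ i → c t i ≡ true × f i ≡ L t
  extend (l , small′) with hitting-labelling a (survives l) (λ t → c t ∘ suc) L small′
  ... | f , good = f′ , good′
    where
    f′ : Fin (suc e) → Fin (suc a)
    f′ zero    = l
    f′ (suc i) = f i
    good′ : ∀ t → act t ≡ true → ∃ λ i → c t i ≡ true × f′ i ≡ L t
    good′ t active with hit (c t zero) (L t) l in h
    ... | true  = zero , ∧-fst h , sym (does-sound (L t Fin.≟ l) (∧-snd {c t zero} h))
    ... | false with good t (∧-intro active (cong not h))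
    ...   | i , ci , fi = suc i , ci , fi

weight≤ : ∀ a {e} (c : Fin e → Bool) → weight a c ≤ suc a ^ e
weight≤ a {zero}  c = ≤-refl
weight≤ a {suc e} c = *-mono-≤ (factor (c zero)) (weight≤ a (c ∘ suc))
  where
  factor : ∀ b → (if b then a else suc a) ≤ suc a
  factor true  = n≤1+n a
  factor false = ≤-refl

-- The probability of missing a label on k points is (a / (1 + a))^k, and further points only lower
-- it; denominators are cleared.
weight-bound : ∀ a {e} (c : Fin e → Bool) k → k ≤ card c → weight a c * suc a ^ k ≤ a ^ k * suc a ^ e
weight-bound a {e}     c zero le = begin
  weight a c * 1    ≡⟨ *-identityʳ _ ⟩
  weight a c        ≤⟨ weight≤ a c ⟩
  suc a ^ e         ≡⟨ *-identityˡ _ ⟨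
  1 * suc a ^ e     ∎
  where open ≤-Reasoning
weight-bound a {suc e} c (suc k) le with c zero
... | true  = begin
  a * w * (suc a * suc a ^ k)        ≡⟨ swap a w (suc a) (suc a ^ k) ⟩
  a * suc a * (w * suc a ^ k)        ≤⟨ *-monoʳ-≤ (a * suc a) (weight-bound a (c ∘ suc) k (s≤s⁻¹ le)) ⟩
  a * suc a * (a ^ k * suc a ^ e)    ≡⟨ swap a (suc a) (a ^ k) (suc a ^ e) ⟩
  a * a ^ k * (suc a * suc a ^ e)    ∎
  where
  open ≤-Reasoning
  w = weight a (c ∘ suc)
  swap : ∀ x y z t → x * y * (z * t) ≡ x * z * (y * t)
  swap = solve-∀
... | false = begin
  suc a * w * suc a ^ suc k                ≡⟨ *-assoc (suc a) w _ ⟩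
  suc a * (w * suc a ^ suc k)              ≤⟨ *-monoʳ-≤ (suc a) (weight-bound a (c ∘ suc) (suc k) le) ⟩
  suc a * (a ^ suc k * suc a ^ e)          ≡⟨ swap (suc a) (a ^ suc k) (suc a ^ e) ⟩
  a ^ suc k * (suc a * suc a ^ e)          ∎
  where
  open ≤-Reasoning
  w = weight a (c ∘ suc)
  swap : ∀ x y z → x * (y * z) ≡ y * (x * z)
  swap = solve-∀

-- Bernoulli's inequality (1 + 1/a)^j ≥ 1 + j/a, multiplied by a^(j + 1).
bernoulli : ∀ a j → a ^ j * (a + j) ≤ suc a ^ j * a
bernoulli a zero    = ≤-reflexive (cong (1 *_) (+-identityʳ a))
bernoulli a (suc j) = begin
  a * a ^ j * (a + suc j)          ≡⟨ *-assoc a (a ^ j) _ ⟩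
  a * (a ^ j * (a + suc j))        ≡⟨ expandˡ a (a ^ j) j ⟩
  a ^ j * (a * (a + suc j))        ≤⟨ *-monoʳ-≤ (a ^ j) (≤-trans (m≤m+n _ j) (≤-reflexive (expandʳ a j))) ⟩
  a ^ j * (suc a * (a + j))        ≡⟨ swap (a ^ j) (suc a) (a + j) ⟩
  suc a * (a ^ j * (a + j))        ≤⟨ *-monoʳ-≤ (suc a) (bernoulli a j) ⟩
  suc a * (suc a ^ j * a)          ≡⟨ *-assoc (suc a) (suc a ^ j) a ⟨
  suc a * suc a ^ j * a            ∎
  where
  open ≤-Reasoning
  expandˡ : ∀ a p j → a * (p * (a + suc j)) ≡ p * (a * (a + suc j))
  expandˡ = solve-∀
  expandʳ : ∀ a j → a * (a + suc j) + j ≡ suc a * (a + j)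
  expandʳ = solve-∀
  swap : ∀ x y z → x * (y * z) ≡ y * (x * z)
  swap = solve-∀

-- Bernoulli at j = 1 + a, where 1 + j/a exceeds 2. Each block of 1 + a edges thus at least halves
-- the probability of missing a label.
double-power : ∀ a → 1 ≤ a → 2 * a ^ suc a ≤ suc a ^ suc a
double-power a@(suc a′) _ = *-cancelʳ-≤ _ _ a (begin
  2 * a ^ suc a * a              ≡⟨ regroup (a ^ suc a) a ⟩
  a ^ suc a * (a + a)            ≤⟨ *-monoʳ-≤ (a ^ suc a) (+-monoʳ-≤ a (n≤1+n a)) ⟩
  a ^ suc a * (a + suc a)        ≤⟨ bernoulli a (suc a) ⟩
  suc a ^ suc a * a              ∎)
  where
  open ≤-Reasoning
  regroup : ∀ p a → 2 * p * a ≡ p * (a + a)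
  regroup = solve-∀

-- Labellings in which disjoint s-sets span every label

pair : ∀ {N} → Fin N → Fin N → Fin (N * N)
pair x y with x Fin.≤? y
... | yes _ = combine x y
... | no  _ = combine y x

pair-sym : ∀ {N} (x y : Fin N) → pair x y ≡ pair y x
pair-sym x y with x Fin.≤? y | y Fin.≤? x
... | yes p | yes q = cong₂ combine (Fin.≤-antisym p q) (Fin.≤-antisym q p)
... | yes p | no  _ = refl
... | no  _ | yes _ = refl
... | no ¬p | no ¬q = contradiction (≰⇒≥ ¬q) ¬p

pair-injective : ∀ {N} (x y u v : Fin N) → pair x y ≡ pair u v → (x ≡ u × y ≡ v) ⊎ (x ≡ v × y ≡ u)
pair-injective x y u v eq with x Fin.≤? y | u Fin.≤? v
... | yes _ | yes _ = inj₁ (Fin.combine-injective x y u v eq)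
... | yes _ | no  _ = inj₂ (Fin.combine-injective x y v u eq)
... | no  _ | yes _ with Fin.combine-injective y x u v eq
...   | p , q = inj₂ (q , p)
pair-injective x y u v eq | no _ | no _ with Fin.combine-injective y x v u eq
... | p , q = inj₁ (q , p)

-- Disjoint s-sets are given by enumerations, because `funToFin` codes an s-tuple in `Fin (N ^ s)`
-- and the union bound needs a finite index type.
SpreadPair : ∀ {N s} → (Fin s → Fin N) → (Fin s → Fin N) → Set
SpreadPair A B = (∀ i j → A i ≡ A j → i ≡ j) × (∀ i j → B i ≡ B j → i ≡ j) × (∀ i j → A i ≢ B j)

spreadPair? : ∀ {N s} (A B : Fin s → Fin N) → Dec (SpreadPair A B)
spreadPair? A B = injective? A ×-dec injective? B ×-dec
  Fin.all? (λ i → Fin.all? (λ j → ¬? (A i Fin.≟ B j)))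
  where
  injective? : ∀ {N s} (A : Fin s → Fin N) → Dec (∀ i j → A i ≡ A j → i ≡ j)
  injective? A = Fin.all? (λ i → Fin.all? (λ j → (A i Fin.≟ A j) →-dec (i Fin.≟ j)))

Universal : ∀ {N m} → ℕ → (Fin (N * N) → Fin m) → Set
Universal {N} {m} s f = ∀ (A B : Fin s → Fin N) → SpreadPair A B → ∀ (l : Fin m) → ∃₂ λ i j → f (pair (A i) (B j)) ≡ l

-- Union bound over triples of two s-tuples and a label. The s * s cross edges of a spread pair are
-- distinct, so a random labelling misses the label on all of them with probability at most (a / (1
-- + a))^(s * s); by hypothesis the number of triples times this is below one.
universal-labelling : ∀ N s a → N ^ s * (N ^ s * suc a) * a ^ (s * s) < suc a ^ (s * s) →
                      ∃ λ (f : Fin (N * N) → Fin (suc a)) → Universal s f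
universal-labelling N s a few = finish (hitting-labelling a act c L small)
  where
  T = N ^ s * (N ^ s * suc a)
  E = N * N
  left right : Fin T → Fin s → Fin N
  left  t = finToFun (proj₁ (remQuot {N ^ s} (N ^ s * suc a) t))
  right t = finToFun (proj₁ (remQuot {N ^ s} (suc a) (proj₂ (remQuot {N ^ s} (N ^ s * suc a) t))))
  L : Fin T → Fin (suc a)
  L t = proj₂ (remQuot {N ^ s} (suc a) (proj₂ (remQuot {N ^ s} (N ^ s * suc a) t)))
  -- Triples whose tuples are not spread keep their place in the index type and are switched off
  -- here.
  act : Fin T → Bool
  act t = does (spreadPair? (left t) (right t))
  cross? : ∀ t e → Dec (∃₂ λ i j → pair (left t i) (right t j) ≡ e)
  cross? t e = Fin.any? (λ i → Fin.any? (λ j → pair (left t i) (right t j) Fin.≟ e))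
  c : Fin T → Fin E → Bool
  c t e = does (cross? t e)
  many : ∀ t → SpreadPair (left t) (right t) → s * s ≤ card (c t)
  many t (injˡ , injʳ , disj) = begin
    s * s                            ≡⟨ card-full (s * s) ⟨
    card {s * s} (λ _ → true)        ≤⟨ card-injection (λ _ → true) (c t) rel total injective ⟩
    card (c t)                       ∎
    where
    open ≤-Reasoning
    at : Fin s × Fin s → Fin E
    at (i , j) = pair (left t i) (right t j)
    rel : Fin (s * s) → Fin E → Bool
    rel k e = does (at (remQuot s k) Fin.≟ e)
    total : ∀ k → true ≡ true → ∃ λ e → c t e ≡ true × rel k e ≡ true
    total k _ = at (remQuot s k) ,
      does-complete (cross? t _) (proj₁ (remQuot {s} s k) , proj₂ (remQuot {s} s k) , refl) ,
      does-complete (at (remQuot s k) Fin.≟ at (remQuot s k)) refl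
    at-injective : ∀ p q → at p ≡ at q → p ≡ q
    at-injective (i , j) (i′ , j′) eq with pair-injective _ _ _ _ eq
    ... | inj₁ (p , q) = cong₂ _,_ (injˡ i i′ p) (injʳ j j′ q)
    -- Unordered pairs may also agree crosswise, but that would put a vertex in both sets.
    ... | inj₂ (p , _) = contradiction p (disj i j′)
    injective : ∀ k k′ e → rel k e ≡ true → rel k′ e ≡ true → k ≡ k′
    injective k k′ e p q = trans (sym (Fin.combine-remQuot {s} s k)) (trans
      (cong (uncurry combine) (at-injective (remQuot s k) (remQuot s k′)
        (trans (does-sound (_ Fin.≟ e) p) (sym (does-sound (_ Fin.≟ e) q)))))
      (Fin.combine-remQuot {s} s k′))
  small : sum (λ t → bit (act t) * weight a (c t)) < suc a ^ E
  small = *-cancelʳ-< (suc a ^ (s * s)) _ _ (begin-strict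
    sum (λ t → bit (act t) * weight a (c t)) * suc a ^ (s * s)
                                              ≡⟨ *-distribʳ-sum (suc a ^ (s * s)) (λ t → bit (act t) * weight a (c t)) ⟩
    sum (λ t → bit (act t) * weight a (c t) * suc a ^ (s * s))
                                              ≤⟨ sum-mono each ⟩
    sum {T} (λ _ → a ^ (s * s) * suc a ^ E)   ≡⟨ sum-const T (a ^ (s * s) * suc a ^ E) ⟩
    T * (a ^ (s * s) * suc a ^ E)             ≡⟨ *-assoc T (a ^ (s * s)) (suc a ^ E) ⟨
    T * a ^ (s * s) * suc a ^ E               <⟨ *-monoˡ-< (suc a ^ E) {{m^n≢0 (suc a) E}} few ⟩
    suc a ^ (s * s) * suc a ^ E               ≡⟨ *-comm (suc a ^ (s * s)) (suc a ^ E) ⟩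
    suc a ^ E * suc a ^ (s * s)               ∎)
    where
    open ≤-Reasoning
    each : ∀ t → bit (act t) * weight a (c t) * suc a ^ (s * s) ≤ a ^ (s * s) * suc a ^ E
    each t = by-activity (act t) (λ p → many t (does-sound (spreadPair? (left t) (right t)) p))
      where
      by-activity : ∀ b → (b ≡ true → s * s ≤ card (c t)) →
                    bit b * weight a (c t) * suc a ^ (s * s) ≤ a ^ (s * s) * suc a ^ E
      by-activity false _   = z≤n
      by-activity true  big = ≤-trans (≤-reflexive (cong (_* suc a ^ (s * s)) (+-identityʳ (weight a (c t)))))
                                      (weight-bound a (c t) (s * s) (big refl))
  finish : (∃ λ (f : Fin E → Fin (suc a)) → ∀ t → act t ≡ true → ∃ λ i → c t i ≡ true × f i ≡ L t) →
           ∃ λ (f : Fin E → Fin (suc a)) → Universal s f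
  finish (f , good) = f , universal
    where
    universal : Universal s f
    universal A B (injA , injB , disj) l = result (good t (does-complete (spreadPair? (left t) (right t)) spread))
      where
      t : Fin T
      t = combine (funToFin A) (combine (funToFin B) l)
      outer : remQuot {N ^ s} (N ^ s * suc a) t ≡ (funToFin A , combine (funToFin B) l)
      outer = Fin.remQuot-combine (funToFin A) (combine (funToFin B) l)
      inner : remQuot {N ^ s} (suc a) (proj₂ (remQuot {N ^ s} (N ^ s * suc a) t)) ≡ (funToFin B , l)
      inner = trans (cong (remQuot {N ^ s} (suc a) ∘ proj₂) outer) (Fin.remQuot-combine (funToFin B) l)
      left≗ : ∀ i → left t i ≡ A i
      left≗ i = trans (cong (λ z → finToFun (proj₁ z) i) outer) (Fin.finToFun-funToFin A i)
      right≗ : ∀ i → right t i ≡ B i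
      right≗ i = trans (cong (λ z → finToFun (proj₁ z) i) inner) (Fin.finToFun-funToFin B i)
      spread : SpreadPair (left t) (right t)
      spread = (λ i j eq → injA i j (trans (sym (left≗ i)) (trans eq (left≗ j))))
             , (λ i j eq → injB i j (trans (sym (right≗ i)) (trans eq (right≗ j))))
             , (λ i j eq → disj i j (trans (sym (left≗ i)) (trans eq (right≗ j))))
      result : (∃ λ e → c t e ≡ true × f e ≡ L t) → ∃₂ λ i j → f (pair (A i) (B j)) ≡ l
      result (e , ce , fe) with does-sound (cross? t e) ce
      ... | i , j , eq = i , j , trans (cong f (trans (sym (cong₂ pair (left≗ i) (right≗ j))) eq))
                                       (trans fe (cong proj₂ inner))

-- Induction along a degeneracy order

remove : ∀ {n} → (Fin n → Bool) → Fin n → Fin n → Bool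
remove S v u = S u ∧ not (does (u Fin.≟ v))

remove-∈ : ∀ {n} (S : Fin n → Bool) {u v} → S u ≡ true → u ≢ v → remove S v u ≡ true
remove-∈ S {u} {v} p u≢v = ∧-intro p (cong not (does-refute (u Fin.≟ v) u≢v))

remove-≢ : ∀ {n} (S : Fin n → Bool) {u v} → remove S v u ≡ true → u ≢ v
remove-≢ S {u} {v} p refl with S u | u Fin.≟ u | p
... | true | no u≢u | _ = u≢u refl

remove-∉ : ∀ {n} (S : Fin n → Bool) {u} v → S u ≡ false → remove S v u ≡ false
remove-∉ S v p rewrite p = refl

remove-∉⁻ : ∀ {n} (S : Fin n → Bool) u v → remove S v u ≡ false → S u ≡ false ⊎ u ≡ v
remove-∉⁻ S u v p with S u | u Fin.≟ v
... | false | _      = inj₁ refl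
... | true  | yes eq = inj₂ eq

remove-self : ∀ {n} (S : Fin n → Bool) v → remove S v v ≡ false
remove-self S v = trans (cong (λ b → S v ∧ not b) (does-complete (v Fin.≟ v) refl)) (Bool.∧-zeroʳ (S v))

card-remove : ∀ {n} (S : Fin n → Bool) v → S v ≡ true → suc (card (remove S v)) ≤ card S
card-remove S v v∈S = begin
  1 + card (remove S v)                         ≤⟨ +-monoˡ-≤ _ (card-positive is-v v (does-complete (v Fin.≟ v) refl)) ⟩
  card is-v + card (remove S v)                 ≡⟨ ∑-distrib-+ (bit ∘ is-v) (bit ∘ remove S v) ⟨
  sum (λ u → bit (is-v u) + bit (remove S v u)) ≤⟨ sum-mono pointwise ⟩
  card S                                        ∎
  where
  open ≤-Reasoning
  is-v : _ → Bool
  is-v u = does (u Fin.≟ v)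
  pointwise : ∀ u → bit (is-v u) + bit (remove S v u) ≤ bit (S u)
  pointwise u with u Fin.≟ v
  ... | yes refl rewrite v∈S = ≤-refl
  ... | no  _    rewrite Bool.∧-identityʳ (S u) = ≤-refl

card-tabulate : ∀ {n} (P : Fin n → Bool) → ∣ tabulate P ∣ ≡ card P
card-tabulate {zero}  P = refl
card-tabulate {suc n} P with P zero
... | true  = cong suc (card-tabulate (P ∘ suc))
... | false = card-tabulate (P ∘ suc)

tabulate-∧ : ∀ {n} (P Q : Fin n → Bool) → tabulate P ∩ tabulate Q ≡ tabulate (λ u → P u ∧ Q u)
tabulate-∧ {zero}  P Q = refl
tabulate-∧ {suc n} P Q = cong₂ Vec._∷_ refl (tabulate-∧ (P ∘ suc) (Q ∘ suc))

module _ {n d} {H : EOGraph n} (degenerate : Degenerate d H) where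

  low-degree-vertex : ∀ (S : Fin n → Bool) → 1 ≤ card S → ∃ λ v → S v ≡ true × card (λ u → S u ∧ adj H v u) ≤ d
  low-degree-vertex S pos with card-nonempty S pos
  ... | u , u∈S with degenerate (tabulate S) (u , lookup⇒[]= u (tabulate S) (trans (lookup∘tabulate S u) u∈S))
  ... | v , v∈S , small = v , trans (sym (lookup∘tabulate S v)) ([]=⇒lookup v∈S)
      , ≤-trans (≤-reflexive (sym (trans (cong ∣_∣ (tabulate-∧ S (adj H v))) (card-tabulate (λ u → S u ∧ adj H v u))))) small

  -- Vertices of degree at most d are peeled off until none is left, and `P` is rebuilt in the
  -- reverse order; a vertex therefore joins when at most d of its neighbours are present.
  degenerate-induction : (P : (Fin n → Bool) → Set) →
    (∀ S → (∀ u → S u ≡ false) → P S) →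
    (∀ S v → S v ≡ true → card (λ u → S u ∧ adj H v u) ≤ d → P (remove S v) → P S) →
    ∀ S → P S
  degenerate-induction P base step S = go (card S) S ≤-refl
    where
    go : ∀ k S → card S ≤ k → P S
    go k S le with 1 ≤? card S
    go k S le | no empty = base S λ u → Bool.¬-not (λ p → empty (card-positive S u p))
    go zero S le | yes pos = contradiction (≤-trans pos le) λ ()
    go (suc k) S le | yes pos with low-degree-vertex S pos
    ... | v , v∈S , small = step S v v∈S small (go k (remove S v) (s≤s⁻¹ (≤-trans (card-remove S v v∈S) le)))

  -- Greedy colouring in the reverse peeling order: the at most d neighbours that are already
  -- coloured cannot use up c > d colours.
  proper-colouring : ∀ c → d < c → ∃ λ (χ : Fin n → Fin c) → ∀ u v → adj H u v ≡ true → χ u ≢ χ v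
  proper-colouring c d<c with degenerate-induction Proper base step (λ _ → true)
    where
    Proper : (Fin n → Bool) → Set
    Proper S = ∃ λ (χ : Fin n → Fin c) → ∀ u v → S u ≡ true → S v ≡ true → adj H u v ≡ true → χ u ≢ χ v
    base : ∀ S → (∀ u → S u ≡ false) → Proper S
    base S empty = (λ _ → fromℕ< d<c) , λ u v u∈S → contradiction (trans (sym u∈S) (empty u)) λ ()
    step : ∀ S v → S v ≡ true → card (λ u → S u ∧ adj H v u) ≤ d → Proper (remove S v) → Proper S
    step S v v∈S small (χ , proper) = extend (Fin.any? free?)
      where
      Used : Fin c → Set
      Used k = ∃ λ u → (remove S v u ∧ adj H v u) ≡ true × χ u ≡ k
      used? : ∀ k → Dec (Used k)
      used? k = Fin.any? (λ u → ((remove S v u ∧ adj H v u) Bool.≟ true) ×-dec (χ u Fin.≟ k))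
      free? : ∀ k → Dec (¬ Used k)
      free? k = ¬? (used? k)
      extend : Dec (∃ λ k → ¬ Used k) → Proper S
      extend (no all-used) = contradiction (begin
        c                                          ≡⟨ card-full c ⟨
        card {c} (λ _ → true)                      ≤⟨ card-injection (λ _ → true) (λ u → S u ∧ adj H v u)
                                                        (λ k u → does (χ u Fin.≟ k)) total
                                                        (λ k k′ u p q → trans (sym (does-sound (χ u Fin.≟ k) p)) (does-sound (χ u Fin.≟ k′) q)) ⟩
        card (λ u → S u ∧ adj H v u)               ≤⟨ small ⟩
        d                                          ∎) (<⇒≱ d<c)
        where
        open ≤-Reasoning
        total : ∀ k → true ≡ true → ∃ λ u → S u ∧ adj H v u ≡ true × does (χ u Fin.≟ k) ≡ true
        total k _ with used? k
        ... | no free = contradiction (k , free) all-used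
        ... | yes (u , mem , eq) = u , ∧-intro (∧-fst (∧-fst mem)) (∧-snd {remove S v u} mem) , does-complete (χ u Fin.≟ k) eq
      extend (yes (k , free)) = χ′ , proper′
        where
        χ′ : Fin n → Fin c
        χ′ u with u Fin.≟ v
        ... | yes _ = k
        ... | no  _ = χ u
        proper′ : ∀ u w → S u ≡ true → S w ≡ true → adj H u w ≡ true → χ′ u ≢ χ′ w
        proper′ u w u∈S w∈S edge with u Fin.≟ v | w Fin.≟ v
        ... | yes refl | yes refl = contradiction (trans (sym edge) (adj-irr H u)) λ ()
        ... | yes refl | no w≢v   = λ eq → free (w , ∧-intro (remove-∈ S w∈S w≢v) edge , sym eq)
        ... | no u≢v   | yes refl = λ eq → free (u , ∧-intro (remove-∈ S u∈S u≢v) (trans (adj-sym H w u) edge) , eq)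
        ... | no u≢v   | no w≢v   = proper u w (remove-∈ S u∈S u≢v) (remove-∈ S w∈S w≢v) edge
  ... | χ , proper = χ , λ u v → proper u v refl refl

-- Greedy embedding and its obstruction

record Embedding {n N} (H : EOGraph n) (R : Fin n → Fin n → Fin N → Fin N → Bool) (C : Fin n → Fin N → Bool) : Set where
  field
    map     : Fin n → Fin N
    map-∈   : ∀ u → C u (map u) ≡ true
    map-inj : ∀ u v → map u ≡ map v → u ≡ v
    map-rel : ∀ u v → adj H u v ≡ true → R u v (map u) (map v) ≡ true

-- What remains when the greedy embedding gets stuck. `A` and `B` have lost only factors K^d and n *
-- K^d against their candidate sets, and each vertex of `B` is related to less than a 1/K proportion
-- of `A`. The relation depends on u and v because each edge of H asks for labels from its own
-- interval.
record SparsePair {n N} (d : ℕ) (H : EOGraph n) (K : ℕ) (R : Fin n → Fin n → Fin N → Fin N → Bool)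
                  (C : Fin n → Fin N → Bool) : Set where
  field
    u v     : Fin n
    u~v     : adj H u v ≡ true
    A B     : Fin N → Bool
    A⊑C     : A ⊑ C v
    B⊑C     : B ⊑ C u
    A-large : card (C v) ≤ card A * K ^ d
    B-large : card (C u) ≤ n * card B * K ^ d
    sparse  : ∀ x → B x ≡ true → card (λ y → A y ∧ R u v x y) * K < card A

module _ {n d N} (H : EOGraph n) (degenerate : Degenerate d H) (K : ℕ) (K>0 : 1 ≤ K)
  (R : Fin n → Fin n → Fin N → Fin N → Bool) (R-sym : ∀ u v x y → R u v x y ≡ R v u y x)
  (C : Fin n → Fin N → Bool) (large : ∀ u → n * K ^ d < card (C u)) where

  private
    instance
      K-nonZero : NonZero K
      K-nonZero = >-nonZero K>0

    back : (Fin n → Bool) → Fin n → ℕ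
    back S w = card (λ u → S u ∧ adj H w u)

    -- Invariant once the vertices of `S` are placed: an unplaced w keeps in `Cs w` candidates
    -- related to the images of all its placed neighbours, and has lost at most one factor K for
    -- each of them.
    record Partial (S : Fin n → Bool) : Set where
      field
        ψ       : Fin n → Fin N
        Cs      : Fin n → Fin N → Bool
        Cs⊑C    : ∀ w → Cs w ⊑ C w
        ψ-∈     : ∀ u → S u ≡ true → C u (ψ u) ≡ true
        ψ-inj   : ∀ u v → S u ≡ true → S v ≡ true → ψ u ≡ ψ v → u ≡ v
        ψ-rel   : ∀ u v → S u ≡ true → S v ≡ true → adj H u v ≡ true → R u v (ψ u) (ψ v) ≡ true
        Cs-rel  : ∀ u w → S u ≡ true → S w ≡ false → adj H u w ≡ true → ∀ y → Cs w y ≡ true → R u w (ψ u) y ≡ true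
        Cs-size : ∀ w → S w ≡ false → card (C w) ≤ card (Cs w) * K ^ back S w

    -- The premise bounds the loss of each unplaced vertex by K^d. It is vacuous for the full set
    -- and passes from `S` to `remove S v`, since v itself has at most d neighbours in `S`.
    Goal : (Fin n → Bool) → Set
    Goal S = (∀ w → S w ≡ false → back S w ≤ d) → Partial S ⊎ SparsePair d H K R C

    ∉-both : ∀ {a} {X : Set a} {b} → b ≡ true → b ≡ false → X
    ∉-both refl ()

    base : ∀ S → (∀ u → S u ≡ false) → Goal S
    base S empty _ = inj₁ record
      -- Being total, `ψ` needs values on unplaced vertices; any candidate serves as a placeholder.
      { ψ       = λ u → proj₁ (card-nonempty (C u) (≤-trans (s≤s z≤n) (large u)))
      ; Cs      = C
      ; Cs⊑C    = λ w y p → p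
      ; ψ-∈     = λ u p → ∉-both p (empty u)
      ; ψ-inj   = λ u v p → ∉-both p (empty u)
      ; ψ-rel   = λ u v p → ∉-both p (empty u)
      ; Cs-rel  = λ u w p → ∉-both p (empty u)
      ; Cs-size = λ w _ → ≤-trans (≤-reflexive (sym (*-identityʳ _))) (*-monoʳ-≤ (card (C w)) (m^n>0 K (back S w)))
      }

    back-mono : ∀ S v w → back (remove S v) w ≤ back S w
    back-mono S v w = card-mono {P = λ u → remove S v u ∧ adj H w u} {Q = λ u → S u ∧ adj H w u}
      λ u p → ∧-intro (∧-fst (∧-fst p)) (∧-snd {remove S v u} p)

    back-suc : ∀ S v w → S v ≡ true → adj H w v ≡ true → suc (back (remove S v) w) ≤ back S w
    back-suc S v w v∈S w~v = ≤-trans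
      (s≤s (card-mono {P = λ u → remove S v u ∧ adj H w u} {Q = remove (λ u → S u ∧ adj H w u) v}
        λ u p → remove-∈ (λ u → S u ∧ adj H w u) (∧-intro (∧-fst (∧-fst p)) (∧-snd {remove S v u} p)) (remove-≢ S (∧-fst p))))
      (card-remove (λ u → S u ∧ adj H w u) v (∧-intro v∈S w~v))

    extend : ∀ S v → S v ≡ true → (∀ w → S w ≡ false → back S w ≤ d) → back S v ≤ d →
             Partial (remove S v) → Partial S ⊎ SparsePair d H K R C
    extend S v v∈S back≤ back-v≤ partial = choose (Fin.any? good?)
      where
      open Partial partial
      S′ = remove S v
      back′≤ : ∀ w → S w ≡ false → back S′ w ≤ d
      back′≤ w w∉S = ≤-trans (back-mono S v w) (back≤ w w∉S)
      low? : ∀ x u → Dec (card (λ y → Cs u y ∧ R v u x y) * K < card (Cs u))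
      low? x u = card (λ y → Cs u y ∧ R v u x y) * K <? card (Cs u)
      -- Two ways in which u forbids placing v at x: x is already the image of u, or u is a later
      -- neighbour of v whose candidates would shrink by more than a factor K.
      clash : Fin N → Fin n → Bool
      clash x u = (S′ u ∧ does (ψ u Fin.≟ x)) ∨ (not (S u) ∧ (adj H v u ∧ does (low? x u)))
      good? : ∀ x → Dec (Cs v x ≡ true × (∀ u → clash x u ≡ false))
      good? x = (Cs v x Bool.≟ true) ×-dec Fin.all? (λ u → clash x u Bool.≟ false)
      enough : ∀ w → back S′ w ≤ d → card (C w) ≤ card (Cs w) * K ^ back S′ w → card (C w) ≤ card (Cs w) * K ^ d
      enough w le size = ≤-trans size (*-monoʳ-≤ (card (Cs w)) (^-monoʳ-≤ K le))
      v-enough : card (C v) ≤ card (Cs v) * K ^ d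
      v-enough = enough v (≤-trans (back-mono S v v) back-v≤) (Cs-size v (remove-self S v))
      Cs-v>n : n < card (Cs v)
      Cs-v>n = *-cancelʳ-< (K ^ d) n (card (Cs v)) (<-≤-trans (large v) v-enough)

      choose : Dec (∃ λ x → Cs v x ≡ true × (∀ u → clash x u ≡ false)) → Partial S ⊎ SparsePair d H K R C
      choose (no none) = inj₂ (fail (cover-pigeonhole (Cs v) Q (≤-trans (s≤s z≤n) Cs-v>n) covered))
        where
        Q : Fin n → Fin N → Bool
        Q u x = Cs v x ∧ clash x u
        covered : ∀ x → Cs v x ≡ true → ∃ λ u → Q u x ≡ true
        covered x p with Fin.any? (λ u → clash x u Bool.≟ true)
        ... | yes (u , c) = u , ∧-intro p c
        ... | no  free    = contradiction (x , p , λ u → Bool.¬-not (λ c → free (u , c))) none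
        fail : (∃ λ u → card (Cs v) ≤ n * card (Q u)) → SparsePair d H K R C
        fail (u , share) = cases (S′ u) refl (S u) refl
          where
          cases : ∀ b → S′ u ≡ b → ∀ b′ → S u ≡ b′ → SparsePair d H K R C
          -- A placed vertex blocks one candidate only, which is less than a 1/n share of more than
          -- n candidates.
          cases true u∈S′ true u∈S = contradiction share (<⇒≱ (begin-strict
            n * card (Q u)    ≤⟨ *-monoʳ-≤ n (card-subsingleton (Q u) λ x y p q → trans (sym (at x p)) (at y q)) ⟩
            n * 1             ≡⟨ *-identityʳ n ⟩
            n                 <⟨ Cs-v>n ⟩
            card (Cs v)       ∎))
            where
            open ≤-Reasoning
            at : ∀ x → Q u x ≡ true → ψ u ≡ x
            at x p with ∧-snd {Cs v x} p
            ... | c rewrite u∈S′ | u∈S | Bool.∨-identityʳ (does (ψ u Fin.≟ x)) = does-sound (ψ u Fin.≟ x) c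
          cases true u∈S′ false u∉S = ∉-both (∧-fst u∈S′) u∉S
          -- Here u is v itself, which never clashes.
          cases false u∉S′ true u∈S = contradiction share (<⇒≱ (begin-strict
            n * card (Q u)                        ≤⟨ *-monoʳ-≤ n (card-mono {P = Q u} {Q = λ _ → false} none-in) ⟩
            n * card {N} (λ _ → false)            ≡⟨ cong (n *_) (trans (sum-const N 0) (*-zeroʳ N)) ⟩
            n * 0                                 ≡⟨ *-zeroʳ n ⟩
            0                                     <⟨ ≤-trans (s≤s z≤n) Cs-v>n ⟩
            card (Cs v)                           ∎))
            where
            open ≤-Reasoning
            none-in : Q u ⊑ (λ _ → false)
            none-in x p with ∧-snd {Cs v x} p
            ... | c rewrite u∉S′ | u∈S = c
          -- The blame falls on a later neighbour u. Its candidates form `A`, and the candidates of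
          -- v that would deplete them form `B`, so the record exchanges the names u and v.
          cases false u∉S′ false u∉S = record
            { u       = v
            ; v       = u
            ; u~v     = ∧-fst (inside _ (proj₂ member))
            ; A       = Cs u
            ; B       = Q u
            ; A⊑C     = Cs⊑C u
            ; B⊑C     = λ x p → Cs⊑C v x (∧-fst p)
            ; A-large = enough u (back′≤ u u∉S) (Cs-size u u∉S′)
            ; B-large = ≤-trans v-enough (*-monoˡ-≤ (K ^ d) share)
            ; sparse  = λ x p → does-sound (low? x u) (∧-snd {adj H v u} (inside x p))
            }
            where
            inside : ∀ x → Q u x ≡ true → (adj H v u ∧ does (low? x u)) ≡ true
            inside x p with ∧-snd {Cs v x} p
            ... | c rewrite u∉S′ | u∉S = c
            member : ∃ λ x → Q u x ≡ true
            member = card-nonempty (Q u) (n≢0⇒n>0 λ zero-card → contradiction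
              (≤-trans share (≤-reflexive (trans (cong (n *_) zero-card) (*-zeroʳ n)))) (<⇒≱ (≤-trans (s≤s z≤n) Cs-v>n)))
      choose (yes (x , x∈Cs , free)) = inj₁ record
        { ψ       = ψ′
        ; Cs      = Cs′
        ; Cs⊑C    = λ w y p → Cs⊑C w y (∧-fst p)
        ; ψ-∈     = ψ′-∈
        ; ψ-inj   = ψ′-inj
        ; ψ-rel   = ψ′-rel
        ; Cs-rel  = Cs′-rel
        ; Cs-size = Cs′-size
        }
        where
        ψ′ : Fin n → Fin N
        ψ′ u with u Fin.≟ v
        ... | yes _ = x
        ... | no  _ = ψ u
        Cs′ : Fin n → Fin N → Bool
        Cs′ w y = Cs w y ∧ (not (adj H v w) ∨ R v w x y)
        fresh : ∀ u → S′ u ≡ true → ψ u ≢ x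
        fresh u u∈S′ eq with free u
        ... | f rewrite u∈S′ | does-complete (ψ u Fin.≟ x) eq = case f
          where
          case : true ≡ false → ⊥
          case ()
        ψ′-∈ : ∀ u → S u ≡ true → C u (ψ′ u) ≡ true
        ψ′-∈ u u∈S with u Fin.≟ v
        ... | yes refl = Cs⊑C v x x∈Cs
        ... | no  u≢v  = ψ-∈ u (remove-∈ S u∈S u≢v)
        ψ′-inj : ∀ u w → S u ≡ true → S w ≡ true → ψ′ u ≡ ψ′ w → u ≡ w
        ψ′-inj u w u∈S w∈S eq with u Fin.≟ v | w Fin.≟ v
        ... | yes p  | yes q  = trans p (sym q)
        ... | yes _  | no w≢v = contradiction (sym eq) (fresh w (remove-∈ S w∈S w≢v))
        ... | no u≢v | yes _  = contradiction eq (fresh u (remove-∈ S u∈S u≢v))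
        ... | no u≢v | no w≢v = ψ-inj u w (remove-∈ S u∈S u≢v) (remove-∈ S w∈S w≢v) eq
        ψ′-rel : ∀ u w → S u ≡ true → S w ≡ true → adj H u w ≡ true → R u w (ψ′ u) (ψ′ w) ≡ true
        ψ′-rel u w u∈S w∈S u~w with u Fin.≟ v | w Fin.≟ v
        ... | yes refl | yes refl = ∉-both u~w (adj-irr H u)
        ... | yes refl | no w≢v   = trans (R-sym v w x (ψ w))
              (Cs-rel w v (remove-∈ S w∈S w≢v) (remove-self S v) (trans (adj-sym H w v) u~w) x x∈Cs)
        ... | no u≢v   | yes refl = Cs-rel u v (remove-∈ S u∈S u≢v) (remove-self S v) u~w x x∈Cs
        ... | no u≢v   | no w≢v   = ψ-rel u w (remove-∈ S u∈S u≢v) (remove-∈ S w∈S w≢v) u~w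
        Cs′-rel : ∀ u w → S u ≡ true → S w ≡ false → adj H u w ≡ true → ∀ y → Cs′ w y ≡ true → R u w (ψ′ u) y ≡ true
        Cs′-rel u w u∈S w∉S u~w y p with u Fin.≟ v
        ... | no u≢v   = Cs-rel u w (remove-∈ S u∈S u≢v) (remove-∉ S v w∉S) u~w y (∧-fst p)
        ... | yes refl with ∧-snd {Cs w y} p
        ...   | q rewrite u~w = q
        Cs′-size : ∀ w → S w ≡ false → card (C w) ≤ card (Cs′ w) * K ^ back S w
        Cs′-size w w∉S = cases (adj H v w) refl
          where
          open ≤-Reasoning
          cases : ∀ b → adj H v w ≡ b → card (C w) ≤ card (Cs′ w) * K ^ back S w
          cases false v≁w = begin
            card (C w)                         ≤⟨ Cs-size w (remove-∉ S v w∉S) ⟩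
            card (Cs w) * K ^ back S′ w        ≤⟨ *-mono-≤ (card-mono {P = Cs w} {Q = Cs′ w} keep) (^-monoʳ-≤ K (back-mono S v w)) ⟩
            card (Cs′ w) * K ^ back S w        ∎
            where
            keep : Cs w ⊑ Cs′ w
            keep y p rewrite v≁w = ∧-intro p refl
          cases true v~w = begin
            card (C w)                         ≤⟨ Cs-size w (remove-∉ S v w∉S) ⟩
            card (Cs w) * K ^ back S′ w        ≤⟨ *-monoˡ-≤ (K ^ back S′ w) not-low ⟩
            card (Cs′ w) * K * K ^ back S′ w   ≡⟨ *-assoc (card (Cs′ w)) K (K ^ back S′ w) ⟩
            card (Cs′ w) * K ^ suc (back S′ w) ≤⟨ *-monoʳ-≤ (card (Cs′ w)) (^-monoʳ-≤ K (back-suc S v w v∈S (trans (adj-sym H w v) v~w))) ⟩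
            card (Cs′ w) * K ^ back S w        ∎
            where
            same : (λ y → Cs w y ∧ R v w x y) ⊑ Cs′ w
            same y p rewrite v~w = p
            not-low : card (Cs w) ≤ card (Cs′ w) * K
            not-low = ≤-trans (≮⇒≥ λ lt → absurd (free w) lt)
                              (*-monoˡ-≤ K (card-mono {P = λ y → Cs w y ∧ R v w x y} {Q = Cs′ w} same))
              where
              absurd : clash x w ≡ false → card (λ y → Cs w y ∧ R v w x y) * K < card (Cs w) → ⊥
              absurd c lt rewrite w∉S | v~w | does-complete (low? x w) lt with c
              ... | ()

    step : ∀ S v → S v ≡ true → back S v ≤ d → Goal (remove S v) → Goal S
    step S v v∈S back-v≤ goal back≤ with goal back′≤
      where
      back′≤ : ∀ w → remove S v w ≡ false → back (remove S v) w ≤ d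
      back′≤ w w∉S′ with remove-∉⁻ S w v w∉S′
      ... | inj₁ w∉S  = ≤-trans (back-mono S v w) (back≤ w w∉S)
      ... | inj₂ refl = ≤-trans (back-mono S v v) back-v≤
    ... | inj₁ partial = extend S v v∈S back≤ back-v≤ partial
    ... | inj₂ sparse  = inj₂ sparse

  greedy : Embedding H R C ⊎ SparsePair d H K R C
  greedy with degenerate-induction {d = d} {H = H} degenerate Goal base step (λ _ → true) (λ _ ())
  ... | inj₂ sparse  = inj₂ sparse
  ... | inj₁ partial = inj₁ record
    { map     = ψ
    ; map-∈   = λ u → ψ-∈ u refl
    ; map-inj = λ u v → ψ-inj u v refl refl
    ; map-rel = λ u v → ψ-rel u v refl refl
    }
    where open Partial partial

-- Degrees between sets and Markov's inequality

degree : ∀ {N} → (Fin N → Fin N → Bool) → (Fin N → Bool) → Fin N → ℕ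
degree rel X y = card (λ x → X x ∧ rel y x)

degree-mono : ∀ {N} (rel rel′ : Fin N → Fin N → Bool) (X X′ : Fin N → Bool) y →
              rel y ⊑ rel′ y → X ⊑ X′ → degree rel X y ≤ degree rel′ X′ y
degree-mono rel rel′ X X′ y rel⊑ X⊑ = card-mono {P = λ x → X x ∧ rel y x} {Q = λ x → X′ x ∧ rel′ y x}
  λ x p → ∧-intro (X⊑ x (∧-fst p)) (rel⊑ x (∧-snd {X x} p))

-- Both sides count the related pairs between X and Y.
degree-swap : ∀ {N} (rel : Fin N → Fin N → Bool) → (∀ x y → rel x y ≡ rel y x) → ∀ X Y →
              sum (λ y → bit (Y y) * degree rel X y) ≡ sum (λ x → bit (X x) * degree rel Y x)
degree-swap {N} rel rel-sym X Y = trans (sum-cong-≗ (expand X Y)) (trans (∑-comm (λ y x → bit (Y y) * bit (X x ∧ rel y x)))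
  (trans (sum-cong-≗ (λ x → sum-cong-≗ (λ y → flip (Y y) (X x) (rel-sym y x)))) (sym (sum-cong-≗ (expand Y X)))))
  where
  expand : ∀ X Y y → bit (Y y) * degree rel X y ≡ sum (λ x → bit (Y y) * bit (X x ∧ rel y x))
  expand X Y y = *-distribˡ-sum (bit (Y y)) (λ x → bit (X x ∧ rel y x))
  flip : ∀ a b {c d} → c ≡ d → bit a * bit (b ∧ c) ≡ bit b * bit (a ∧ d)
  flip true  true  refl = refl
  flip true  false refl = refl
  flip false true  refl = refl
  flip false false refl = refl

-- Markov's inequality after exchanging the roles of X and Y.
few-heavy : ∀ {N} (rel : Fin N → Fin N → Bool) → (∀ x y → rel x y ≡ rel y x) → ∀ X Y P Q K → 1 ≤ card X →
            (∀ x → X x ≡ true → degree rel Y x * P ≤ card Y * Q) →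
            card (λ y → Y y ∧ does (card X <? degree rel X y * K)) * P ≤ K * (card Y * Q)
few-heavy {N} rel rel-sym X Y P Q K pos light = *-cancelˡ-≤ (card X) {{>-nonZero pos}} (begin
  card X * (heavy * P)                                 ≡⟨ shuffle₁ (card X) heavy P ⟩
  heavy * card X * P                                   ≤⟨ *-monoˡ-≤ P markov ⟩
  sum (λ y → bit (Y y) * degree rel X y) * K * P       ≡⟨ cong (λ z → z * K * P) (degree-swap rel rel-sym X Y) ⟩
  sum (λ x → bit (X x) * degree rel Y x) * K * P       ≡⟨ shuffle₂ (sum (λ x → bit (X x) * degree rel Y x)) K P ⟩
  K * (sum (λ x → bit (X x) * degree rel Y x) * P)     ≡⟨ cong (K *_) (*-distribʳ-sum P (λ x → bit (X x) * degree rel Y x)) ⟩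
  K * sum (λ x → bit (X x) * degree rel Y x * P)       ≤⟨ *-monoʳ-≤ K (sum-mono (λ x → each x (X x) refl)) ⟩
  K * sum (λ x → bit (X x) * (card Y * Q))             ≡⟨ cong (K *_) (*-distribʳ-sum (card Y * Q) (bit ∘ X)) ⟨
  K * (card X * (card Y * Q))                          ≡⟨ shuffle₃ K (card X) (card Y * Q) ⟩
  card X * (K * (card Y * Q))                          ∎)
  where
  open ≤-Reasoning
  heavy? : ∀ y → Dec (card X < degree rel X y * K)
  heavy? y = card X <? degree rel X y * K
  heavy = card (λ y → Y y ∧ does (heavy? y))
  shuffle₁ : ∀ a b c → a * (b * c) ≡ b * a * c
  shuffle₁ = solve-∀
  shuffle₂ : ∀ a b c → a * b * c ≡ b * (a * c)
  shuffle₂ = solve-∀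
  shuffle₃ : ∀ a b c → a * (b * c) ≡ b * (a * c)
  shuffle₃ = solve-∀
  markov : heavy * card X ≤ sum (λ y → bit (Y y) * degree rel X y) * K
  markov = begin
    heavy * card X                                     ≡⟨ *-distribʳ-sum (card X) (λ y → bit (Y y ∧ does (heavy? y))) ⟩
    sum (λ y → bit (Y y ∧ does (heavy? y)) * card X)   ≤⟨ sum-mono pointwise ⟩
    sum (λ y → bit (Y y) * degree rel X y * K)         ≡⟨ *-distribʳ-sum K (λ y → bit (Y y) * degree rel X y) ⟨
    sum (λ y → bit (Y y) * degree rel X y) * K         ∎
    where
    pointwise : ∀ y → bit (Y y ∧ does (heavy? y)) * card X ≤ bit (Y y) * degree rel X y * K
    pointwise y = cases (Y y) (does (heavy? y)) (does-sound (heavy? y))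
      where
      cases : ∀ a b → (b ≡ true → card X < degree rel X y * K) → bit (a ∧ b) * card X ≤ bit a * degree rel X y * K
      cases false _     _  = z≤n
      cases true  false _  = z≤n
      cases true  true  lt = subst₂ _≤_ (sym (+-identityʳ _)) (cong (_* K) (sym (+-identityʳ (degree rel X y)))) (<⇒≤ (lt refl))
  each : ∀ x b → X x ≡ b → bit b * degree rel Y x * P ≤ bit b * (card Y * Q)
  each x false _   = z≤n
  each x true  x∈X = subst₂ _≤_ (cong (_* P) (sym (+-identityʳ (degree rel Y x)))) (sym (+-identityʳ _)) (light x x∈X)

half-remains : ∀ {N} (Y Z : Fin N → Bool) → 2 * card (λ y → Y y ∧ Z y) ≤ card Y →
               card Y ≤ 2 * card (λ y → Y y ∧ not (Z y))
half-remains Y Z half = +-cancelˡ-≤ (card Y) _ _ (begin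
  card Y + card Y                          ≡⟨ double (card Y) ⟩
  2 * card Y                               ≤⟨ *-monoʳ-≤ 2 (card-split Y Z) ⟩
  2 * (card Y∧Z + card Y∖Z)                ≡⟨ *-distribˡ-+ 2 (card Y∧Z) (card Y∖Z) ⟩
  2 * card Y∧Z + 2 * card Y∖Z              ≤⟨ +-monoˡ-≤ (2 * card Y∖Z) half ⟩
  card Y + 2 * card Y∖Z                    ∎)
  where
  open ≤-Reasoning
  Y∧Z = λ y → Y y ∧ Z y
  Y∖Z = λ y → Y y ∧ not (Z y)
  double : ∀ a → a + a ≡ 2 * a
  double = solve-∀

-- Ranks of edges and the host graph

edge-below : ∀ {n} → EOGraph n → ℕ → Fin n × Fin n → Bool
edge-below H ℓ (u , v) = adj H u v ∧ does (label H u v <? ℓ)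

below : ∀ {n} → EOGraph n → ℕ → Fin (n * n) → Bool
below {n} H ℓ k = edge-below H ℓ (remQuot {n} n k)

-- Counts ordered pairs, hence each edge twice. It is enough that ranks increase strictly with the
-- label and stay below n * n, the branching number of the tree of intervals.
rank : ∀ {n} → EOGraph n → ℕ → ℕ
rank H ℓ = card (below H ℓ)

below-combine : ∀ {n} (H : EOGraph n) ℓ u v → below H ℓ (combine u v) ≡ edge-below H ℓ (u , v)
below-combine H ℓ u v = cong (edge-below H ℓ) (Fin.remQuot-combine u v)

below-self : ∀ {n} (H : EOGraph n) u v k → below H (label H u v) k ≡ true → k ≢ combine u v
below-self H u v k p refl = n≮n _ (does-sound (label H u v <? label H u v)
  (∧-snd {adj H u v} (trans (sym (below-combine H (label H u v) u v)) p)))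

-- The pair (u , v) itself lies below ℓ but not below its own label.
rank-mono : ∀ {n} (H : EOGraph n) u v ℓ → adj H u v ≡ true → label H u v < ℓ → rank H (label H u v) < rank H ℓ
rank-mono {n} H u v ℓ edge lt = ≤-trans
  (s≤s (card-mono {P = below H (label H u v)} {Q = remove (below H ℓ) (combine u v)} λ k p →
    remove-∈ (below H ℓ) (weaken (remQuot {n} n k) p) (below-self H u v k p)))
  (card-remove (below H ℓ) (combine u v)
    (trans (below-combine H ℓ u v) (∧-intro edge (does-complete (label H u v <? ℓ) lt))))
  where
  weaken : ∀ e → edge-below H (label H u v) e ≡ true → edge-below H ℓ e ≡ true
  weaken (x , y) p = ∧-intro (∧-fst p) (does-complete (label H x y <? ℓ)
    (<-trans (does-sound (label H x y <? label H u v) (∧-snd {adj H x y} p)) lt))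

rank< : ∀ {n} (H : EOGraph n) u v → rank H (label H u v) < n * n
rank< {n} H u v = subst (rank H (label H u v) <_) (card-full (n * n)) (≤-trans
  (s≤s (card-mono {P = below H (label H u v)} {Q = remove (λ _ → true) (combine u v)} λ k p →
    remove-∈ (λ _ → true) refl (below-self H u v k p)))
  (card-remove (λ _ → true) (combine u v) refl))

-- Labels are ordered lexicographically: first by the value of `f`, then by the code of the pair.
-- The code makes them distinct, and `f` decides whenever its values differ.
host : ∀ {N M} → (Fin (N * N) → Fin M) → EOGraph N
host {N} f = record
  { adj       = λ x y → not (does (x Fin.≟ y))
  ; adj-sym   = λ x y → cong not (does-⇔ (mk⇔ sym sym) (x Fin.≟ y) (y Fin.≟ x))
  ; adj-irr   = λ x → cong not (does-complete (x Fin.≟ x) refl)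
  ; label     = λ x y → toℕ (combine (f (pair x y)) (pair x y))
  ; label-sym = λ x y → cong (λ p → toℕ (combine (f p) p)) (pair-sym x y)
  ; label-inj = λ u v x y _ _ eq → pair-injective u v x y
      (Fin.combine-injectiveʳ (f (pair u v)) (pair u v) (f (pair x y)) (pair x y) (Fin.toℕ-injective eq))
  }

host-label-mono : ∀ {N M} (f : Fin (N * N) → Fin M) x y x′ y′ → toℕ (f (pair x y)) < toℕ (f (pair x′ y′)) →
                  label (host f) x y < label (host f) x′ y′
host-label-mono {N} f x y x′ y′ lt = Fin.combine-monoˡ-< (pair {N} x y) (pair {N} x′ y′) lt

-- Clusters of low mutual red density

-- Intervals of labels are written (a , r), for a ≤ label < a + (n * n) ^ r; the h rounds producing 2 ^ h
-- sets descend from exponent depth r h to exponent r.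
depth : ℕ → ℕ → ℕ
depth r zero    = r
depth r (suc h) = suc (depth (depth r h) h)

-- A round costs n * K^d for passing to a sparse pair and 2 for discarding up to half of one of its
-- sets.
clusterSize : (n d K base : ℕ) → ℕ → ℕ
clusterSize n d K base zero    = base
clusterSize n d K base (suc h) = 2 * n * K ^ d * clusterSize n d K base h

module _ {n N M} (H : EOGraph n) (f : Fin (N * N) → Fin M) (c : Colouring N) where

  private
    q : ℕ
    q = n * n

    ℓ : Fin n → Fin n → ℕ
    ℓ u v = rank H (label H u v)

    F : Fin N → Fin N → ℕ
    F x y = toℕ (f (pair x y))

    F-sym : ∀ x y → F x y ≡ F y x
    F-sym x y = cong (toℕ ∘ f) (pair-sym x y)

  Link : Bool → ℕ → ℕ → Fin N → Fin N → Set
  Link b a r x y = x ≢ y × col c x y ≡ b × a ≤ F x y × F x y < a + q ^ r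

  link? : ∀ b a r x y → Dec (Link b a r x y)
  link? b a r x y = ¬? (x Fin.≟ y) ×-dec (col c x y Bool.≟ b) ×-dec (a ≤? F x y) ×-dec (F x y <? a + q ^ r)

  link : Bool → ℕ → ℕ → Fin N → Fin N → Bool
  link b a r x y = does (link? b a r x y)

  Link-sym : ∀ b a r x y → Link b a r x y → Link b a r y x
  Link-sym b a r x y (x≢y , colour , lo , hi) = x≢y ∘ sym , trans (col-sym c y x) colour ,
    subst (a ≤_) (F-sym x y) lo , subst (_< a + q ^ r) (F-sym x y) hi

  link-sym : ∀ b a r x y → link b a r x y ≡ link b a r y x
  link-sym b a r x y = does-⇔ (mk⇔ (Link-sym b a r x y) (Link-sym b a r y x)) (link? b a r x y) (link? b a r y x)

  Sub : ℕ → ℕ → ℕ → ℕ → Set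
  Sub a′ r′ a r = a ≤ a′ × a′ + q ^ r′ ≤ a + q ^ r

  Sub-trans : ∀ {a r a′ r′ a″ r″} → Sub a″ r″ a′ r′ → Sub a′ r′ a r → Sub a″ r″ a r
  Sub-trans (p , p′) (r , r′) = ≤-trans r p , ≤-trans p′ r′

  link-mono : ∀ b {a r a′ r′} → Sub a′ r′ a r → ∀ x → link b a′ r′ x ⊑ link b a r x
  link-mono b {a} {r} {a′} {r′} (lo , hi) x y p with does-sound (link? b a′ r′ x y) p
  ... | x≢y , colour , lo′ , hi′ = does-complete (link? b a r x y) (x≢y , colour , ≤-trans lo lo′ , ≤-trans hi′ hi)

  childLink : Bool → ℕ → ℕ → Fin n → Fin n → Fin N → Fin N → Bool
  childLink b a r u v = link b (a + ℓ u v * q ^ r) r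

  childLink-sym : ∀ b a r u v x y → childLink b a r u v x y ≡ childLink b a r v u y x
  childLink-sym b a r u v x y = trans (cong (λ k → link b (a + rank H k * q ^ r) r x y) (label-sym H u v))
                                      (link-sym b (a + ℓ v u * q ^ r) r x y)

  child-Sub : ∀ a r u v → Sub (a + ℓ u v * q ^ r) r a (suc r)
  child-Sub a r u v = m≤m+n a _ , (begin
    a + ℓ u v * q ^ r + q ^ r        ≡⟨ regroup a (ℓ u v) (q ^ r) ⟩
    a + suc (ℓ u v) * q ^ r          ≤⟨ +-monoʳ-≤ a (*-monoˡ-≤ (q ^ r) (rank< H u v)) ⟩
    a + q * q ^ r                    ∎)
    where
    open ≤-Reasoning
    regroup : ∀ a l p → a + l * p + p ≡ a + suc l * p
    regroup = solve-∀

  -- Child intervals are disjoint and arranged by rank, so the order is preserved whichever labels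
  -- are met inside them.
  embedding⇒mono : ∀ b a r {C} → Embedding H (childLink b a r) C → MonoCopy H (host f) c
  embedding⇒mono b a r e = record
    { φ      = map
    ; φ-inj  = map-inj _ _
    ; φ-edge = λ u v edge → cong not (does-refute (map u Fin.≟ map v) (proj₁ (linked u v edge)))
    ; φ-ord  = ord
    ; φ-ord⁻ = ord⁻
    } , b , λ u v edge → proj₁ (proj₂ (linked u v edge))
    where
    open Embedding e
    linked : ∀ u v → Edge H u v → Link b (a + ℓ u v * q ^ r) r (map u) (map v)
    linked u v edge = does-sound (link? b (a + ℓ u v * q ^ r) r (map u) (map v)) (map-rel u v edge)
    ord : ∀ u v x y → Edge H u v → Edge H x y → label H u v < label H x y →
          label (host f) (map u) (map v) < label (host f) (map x) (map y)
    ord u v x y uv xy lt = host-label-mono f (map u) (map v) (map x) (map y) (begin-strict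
      F (map u) (map v)                  <⟨ proj₂ (proj₂ (proj₂ (linked u v uv))) ⟩
      a + ℓ u v * q ^ r + q ^ r          ≡⟨ regroup a (ℓ u v) (q ^ r) ⟩
      a + suc (ℓ u v) * q ^ r            ≤⟨ +-monoʳ-≤ a (*-monoˡ-≤ (q ^ r) (rank-mono H u v (label H x y) uv lt)) ⟩
      a + ℓ x y * q ^ r                  ≤⟨ proj₁ (proj₂ (proj₂ (linked x y xy))) ⟩
      F (map x) (map y)                  ∎)
      where
      open ≤-Reasoning
      regroup : ∀ a l p → a + l * p + p ≡ a + suc l * p
      regroup = solve-∀
    ord⁻ : ∀ u v x y → Edge H u v → Edge H x y →
           label (host f) (map u) (map v) < label (host f) (map x) (map y) → label H u v < label H x y
    ord⁻ u v x y uv xy lt with <-cmp (label H u v) (label H x y)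
    ... | tri< less _ _ = less
    ... | tri> _ _ more = contradiction lt (<-asym (ord x y u v xy uv more))
    -- Equal labels belong to one edge, up to orientation, and its image cannot precede itself.
    ... | tri≈ _ same _ with label-inj H u v x y uv xy same
    ...   | inj₁ (refl , refl) = contradiction lt (n≮n _)
    ...   | inj₂ (refl , refl) = contradiction lt (<-irrefl (label-sym (host f) (map u) (map v)))

  module _ {d} (degenerate : Degenerate d H) (K₁ K₂ base : ℕ) (n>0 : 1 ≤ n) (K₂>0 : 1 ≤ K₂) (base>0 : 1 ≤ base) where

    Low : ℕ → ℕ → (Fin N → Bool) → (Fin N → Bool) → Set
    Low a r X Y = ∀ y → Y y ≡ true → degree (link true a r) X y * K₂ ≤ card X

    -- The interval (`origin` , r₀) lies inside the initial one (a , r). For each pair of sets the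
    -- density bound is known from one side only, depending on which half of a sparse pair each set
    -- came from.
    record Clusters (h a r r₀ : ℕ) (S : Fin N → Bool) : Set where
      field
        origin   : ℕ
        inside  : Sub origin r₀ a r
        W       : Fin (2 ^ h) → Fin N → Bool
        W⊑      : ∀ i → W i ⊑ S
        W-large : ∀ i → base ≤ card (W i)
        W-low   : ∀ i j → i ≢ j → Low origin r₀ (W i) (W j) ⊎ Low origin r₀ (W j) (W i)

    size : ℕ → ℕ
    size = clusterSize n d K₁ base

    -- Induction on h: one sparse pair, then two recursive calls, in B before A because A is first
    -- cleaned of vertices with many red neighbours in some set found in B. The bound on K₁ ensures
    -- that cleaning for 2^h sets costs at most half of A.
    clusters : ∀ h r a S → size h ≤ card S → 2 * 2 ^ h * K₂ ≤ K₁ →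
               MonoCopy H (host f) c ⊎ Clusters h a (depth r h) r S
    clusters zero r a S large _ = inj₂ record
      { origin   = a
      ; inside  = ≤-refl , ≤-refl
      ; W       = λ _ → S
      ; W⊑      = λ _ _ p → p
      ; W-large = λ _ → large
      ; W-low   = λ { zero zero i≢i → contradiction refl i≢i }
      }
    clusters (suc h) r a S large K₁-large =
      red-step (greedy H degenerate K₁ K₁>0 (childLink true a r₂) (childLink-sym true a r₂) (λ _ → S) (λ _ → S-large))
      where
      open ≤-Reasoning
      -- The exponent falls from 1 + r₂ to r₂ with the sparse pair, to r₁ with the recursion in B,
      -- and to r with the recursion in A.
      r₁ r₂ : ℕ
      r₁ = depth r h
      r₂ = depth r₁ h
      instance
        2^h-nonZero : NonZero (2 ^ h)
        2^h-nonZero = m^n≢0 2 h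
        K₂-nonZero : NonZero K₂
        K₂-nonZero = >-nonZero K₂>0
        n-nonZero : NonZero n
        n-nonZero = >-nonZero n>0
      halved : 2 * 2 ^ h * K₂ ≤ K₁
      halved = ≤-trans (*-monoˡ-≤ K₂ (*-monoʳ-≤ 2 (m≤n*m (2 ^ h) 2))) K₁-large
      K₁>0 : 1 ≤ K₁
      K₁>0 = ≤-trans (>-nonZero⁻¹ (2 * 2 ^ h * K₂) {{m*n≢0 (2 * 2 ^ h) K₂ {{m*n≢0 2 (2 ^ h)}}}}) halved
      instance
        K₁^d-nonZero : NonZero (K₁ ^ d)
        K₁^d-nonZero = m^n≢0 K₁ d {{>-nonZero K₁>0}}
        nK-nonZero : NonZero (n * K₁ ^ d)
        nK-nonZero = m*n≢0 n (K₁ ^ d)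
      size>0 : ∀ h → 1 ≤ size h
      size>0 zero    = base>0
      size>0 (suc h) = *-mono-≤ {1} {2 * n * K₁ ^ d}
        (*-mono-≤ {1} {2 * n} (*-mono-≤ {1} {2} (s≤s z≤n) n>0) (>-nonZero⁻¹ (K₁ ^ d))) (size>0 h)
      size-split : ∀ n k s → 2 * n * k * s ≡ 2 * s * (n * k)
      size-split = solve-∀
      S-large : n * K₁ ^ d < card S
      S-large = begin-strict
        n * K₁ ^ d                       <⟨ m<m*n (n * K₁ ^ d) 2 (s≤s (s≤s z≤n)) ⟩
        n * K₁ ^ d * 2                   ≡⟨ *-comm (n * K₁ ^ d) 2 ⟩
        2 * (n * K₁ ^ d)                 ≤⟨ *-monoˡ-≤ (n * K₁ ^ d) (*-monoʳ-≤ 2 (size>0 h)) ⟩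
        2 * size h * (n * K₁ ^ d)        ≡⟨ size-split n (K₁ ^ d) (size h) ⟨
        size (suc h)                     ≤⟨ large ⟩
        card S                           ∎

      red-step : Embedding H (childLink true a r₂) (λ _ → S) ⊎ SparsePair d H K₁ (childLink true a r₂) (λ _ → S) →
                 MonoCopy H (host f) c ⊎ Clusters (suc h) a (suc r₂) r S
      red-step (inj₁ e) = inj₁ (embedding⇒mono true a r₂ e)
      red-step (inj₂ p) = B-step (clusters h r₁ a₁ B B-size halved)
        where
        open SparsePair p
        a₁ : ℕ
        a₁ = a + ℓ u v * q ^ r₂
        A-size : 2 * size h ≤ card A
        A-size = *-cancelʳ-≤ _ _ (K₁ ^ d) (begin
          2 * size h * K₁ ^ d            ≤⟨ *-monoʳ-≤ (2 * size h) (m≤n*m (K₁ ^ d) n) ⟩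
          2 * size h * (n * K₁ ^ d)      ≡⟨ size-split n (K₁ ^ d) (size h) ⟨
          size (suc h)                   ≤⟨ large ⟩
          card S                         ≤⟨ A-large ⟩
          card A * K₁ ^ d                ∎)
        B-size : size h ≤ card B
        B-size = ≤-trans (m≤n*m (size h) 2) (*-cancelʳ-≤ _ _ (n * K₁ ^ d) (begin
          2 * size h * (n * K₁ ^ d)      ≡⟨ size-split n (K₁ ^ d) (size h) ⟨
          size (suc h)                   ≤⟨ large ⟩
          card S                         ≤⟨ B-large ⟩
          n * card B * K₁ ^ d            ≡⟨ shuffle n (card B) (K₁ ^ d) ⟩
          card B * (n * K₁ ^ d)          ∎))
          where
          shuffle : ∀ n b k → n * b * k ≡ b * (n * k)
          shuffle = solve-∀

        B-step : MonoCopy H (host f) c ⊎ Clusters h a₁ r₂ r₁ B → MonoCopy H (host f) c ⊎ Clusters (suc h) a (suc r₂) r S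
        B-step (inj₁ m)  = inj₁ m
        B-step (inj₂ cB) = A-step (clusters h r a₂ A′ A′-size halved)
          where
          module CB = Clusters cB
          a₂ : ℕ
          a₂ = CB.origin
          red : Fin N → Fin N → Bool
          red = link true a₂ r₁
          heavy : Fin (2 ^ h) → Fin N → Bool
          heavy i y = does (card (CB.W i) <? degree red (CB.W i) y * K₂)
          heavy? : ∀ y → Dec (∃ λ i → heavy i y ≡ true)
          heavy? y = Fin.any? (λ i → heavy i y Bool.≟ true)
          some-heavy : Fin N → Bool
          some-heavy y = does (heavy? y)
          A′ : Fin N → Bool
          A′ y = A y ∧ not (some-heavy y)
          -- Vertices of `CB.W i` lie in B and so have few red neighbours in A, all the more within
          -- a subinterval; Markov turns this into a bound on the vertices of A that are heavy for
          -- `CB.W i`.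
          few : ∀ i → card (λ y → A y ∧ heavy i y) * K₁ ≤ K₂ * card A
          few i = subst (λ z → card (λ y → A y ∧ heavy i y) * K₁ ≤ K₂ * z) (*-identityʳ (card A))
            (few-heavy red (link-sym true a₂ r₁) (CB.W i) A K₁ 1 K₂ (≤-trans base>0 (CB.W-large i)) λ x x∈W → begin
              degree red A x * K₁                  ≤⟨ *-monoˡ-≤ K₁ (degree-mono red (childLink true a r₂ u v) A A x
                                                       (link-mono true {a₁} {r₂} {a₂} {r₁} CB.inside x) λ _ z → z) ⟩
              degree (childLink true a r₂ u v) A x * K₁
                                                   ≤⟨ <⇒≤ (sparse x (CB.W⊑ i x x∈W)) ⟩
              card A                               ≡⟨ *-identityʳ (card A) ⟨
              card A * 1                           ∎)
          -- Each of the 2^h sets spoils at most a K₂ / K₁ proportion of A, and 2 * 2^h * K₂ ≤ K₁.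
          half : 2 * card (λ y → A y ∧ some-heavy y) ≤ card A
          half with 1 ≤? card (λ y → A y ∧ some-heavy y)
          ... | no  none = ≤-trans (*-monoʳ-≤ 2 (s≤s⁻¹ (≰⇒> none))) z≤n
          ... | yes some with cover-pigeonhole (λ y → A y ∧ some-heavy y) (λ i y → A y ∧ heavy i y) some
                (λ y p → proj₁ (does-sound (heavy? y) (∧-snd {A y} p)) ,
                         ∧-intro (∧-fst p) (proj₂ (does-sound (heavy? y) (∧-snd {A y} p))))
          ...   | i , share = *-cancelʳ-≤ _ _ (2 ^ h * K₂) {{m*n≢0 (2 ^ h) K₂}} (begin
            2 * t * (2 ^ h * K₂)                 ≡⟨ shuffle₁ t (2 ^ h) K₂ ⟩
            t * (2 * 2 ^ h * K₂)                 ≤⟨ *-monoʳ-≤ t halved ⟩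
            t * K₁                               ≤⟨ *-monoˡ-≤ K₁ share ⟩
            2 ^ h * card (λ y → A y ∧ heavy i y) * K₁
                                                 ≡⟨ *-assoc (2 ^ h) (card (λ y → A y ∧ heavy i y)) K₁ ⟩
            2 ^ h * (card (λ y → A y ∧ heavy i y) * K₁)
                                                 ≤⟨ *-monoʳ-≤ (2 ^ h) (few i) ⟩
            2 ^ h * (K₂ * card A)                ≡⟨ shuffle₂ (2 ^ h) K₂ (card A) ⟩
            card A * (2 ^ h * K₂)                ∎)
            where
            t = card (λ y → A y ∧ some-heavy y)
            shuffle₁ : ∀ t p k → 2 * t * (p * k) ≡ t * (2 * p * k)
            shuffle₁ = solve-∀
            shuffle₂ : ∀ p k a → p * (k * a) ≡ a * (p * k)
            shuffle₂ = solve-∀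
          A′-size : size h ≤ card A′
          A′-size = *-cancelˡ-≤ 2 (≤-trans A-size (half-remains A some-heavy half))

          A-step : MonoCopy H (host f) c ⊎ Clusters h a₂ r₁ r A′ → MonoCopy H (host f) c ⊎ Clusters (suc h) a (suc r₂) r S
          A-step (inj₁ m)  = inj₁ m
          A-step (inj₂ cA) = inj₂ record
            { origin   = a₃
            ; inside  = Sub-trans {a} {suc r₂} {a₂} {r₁} {a₃} {r} CA.inside
                          (Sub-trans {a} {suc r₂} {a₁} {r₂} {a₂} {r₁} CB.inside (child-Sub a r₂ u v))
            ; W       = λ i → W (remQuot {2} (2 ^ h) i)
            ; W⊑      = λ i → W⊑S (remQuot {2} (2 ^ h) i)
            ; W-large = λ i → W-size (remQuot {2} (2 ^ h) i)
            ; W-low   = λ i j i≢j → W-pair (remQuot {2} (2 ^ h) i) (remQuot {2} (2 ^ h) j)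
                (λ eq → i≢j (trans (sym (Fin.combine-remQuot {2} (2 ^ h) i))
                  (trans (cong (uncurry combine) eq) (Fin.combine-remQuot {2} (2 ^ h) j))))
            }
            where
            module CA = Clusters cA
            a₃ : ℕ
            a₃ = CA.origin
            W : Fin 2 × Fin (2 ^ h) → Fin N → Bool
            W (zero     , i) = CB.W i
            W (suc zero , i) = CA.W i
            W⊑S : ∀ p → W p ⊑ S
            W⊑S (zero     , i) x m = B⊑C x (CB.W⊑ i x m)
            W⊑S (suc zero , i) x m = A⊑C x (∧-fst (CA.W⊑ i x m))
            W-size : ∀ p → base ≤ card (W p)
            W-size (zero     , i) = CB.W-large i
            W-size (suc zero , i) = CA.W-large i
            low-mono : ∀ X Y → Low a₂ r₁ X Y → Low a₃ r X Y
            low-mono X Y low y m = ≤-trans (*-monoˡ-≤ K₂ (degree-mono (link true a₃ r) (link true a₂ r₁) X X y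
              (link-mono true {a₂} {r₁} {a₃} {r} CA.inside y) λ _ z → z)) (low y m)
            -- Sets found in A consist of vertices that survived the cleaning.
            low-cross : ∀ i j → Low a₂ r₁ (CB.W i) (CA.W j)
            low-cross i j y m = ≮⇒≥ λ lt → refuted (does-complete (heavy? y)
              (i , does-complete (card (CB.W i) <? degree red (CB.W i) y * K₂) lt))
              where
              refuted : some-heavy y ≡ true → ⊥
              refuted h = clash (trans (sym (cong not h)) (∧-snd {A y} (CA.W⊑ j y m)))
                where
                clash : false ≡ true → ⊥
                clash ()
            W-pair : ∀ p p′ → p ≢ p′ → Low a₃ r (W p) (W p′) ⊎ Low a₃ r (W p′) (W p)
            W-pair (zero , i) (zero , j) p≢p′ with CB.W-low i j (λ i≡j → p≢p′ (cong (zero ,_) i≡j))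
            ... | inj₁ low = inj₁ (low-mono (CB.W i) (CB.W j) low)
            ... | inj₂ low = inj₂ (low-mono (CB.W j) (CB.W i) low)
            W-pair (zero , i) (suc zero , j) _ = inj₁ (low-mono (CB.W i) (CA.W j) (low-cross i j))
            W-pair (suc zero , i) (zero , j) _ = inj₂ (low-mono (CB.W j) (CA.W i) (low-cross j i))
            W-pair (suc zero , i) (suc zero , j) p≢p′ = CA.W-low i j (λ i≡j → p≢p′ (cong (suc zero ,_) i≡j))

-- Separating 2^h sets takes 2^h - 1 sparse pairs, and each uses up one level of the tree.
depth-sum : ∀ r h → suc (depth r h) ≡ r + 2 ^ h
depth-sum r zero    = +-comm 1 r
depth-sum r (suc h) = begin-equality
  suc (suc (depth (depth r h) h))    ≡⟨ cong suc (depth-sum (depth r h) h) ⟩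
  suc (depth r h) + 2 ^ h            ≡⟨ cong (_+ 2 ^ h) (depth-sum r h) ⟩
  r + 2 ^ h + 2 ^ h                  ≡⟨ regroup r (2 ^ h) ⟩
  r + 2 ^ suc h                      ∎
  where
  open ≤-Reasoning
  regroup : ∀ r p → r + p + p ≡ r + 2 * p
  regroup = solve-∀

-- The blue embedding and the Ramsey property of the host

-- Each of s vertices of B has few neighbours in A, hence some s vertices of A have no link to any of them.
unlinked-pair : ∀ {N} (rel : Fin N → Fin N → Bool) s K A B → 1 ≤ s → 8 * s ≤ K → s ≤ card B → 4 * s ≤ card A →
                (∀ x → B x ≡ true → degree rel A x * K ≤ 2 * card A) →
                ∃₂ λ (X Y : Fin s → Fin N) → SpreadPair X Y × (∀ i → B (X i) ≡ true) × (∀ i j → rel (X i) (Y j) ≡ false)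
unlinked-pair {N} rel s K A B s>0 K-large B-large A-large sparse with enumerate s B B-large
... | X , X-inj , X∈B = choose (enumerate s (λ y → A y ∧ not (touched y)) room)
  where
  open ≤-Reasoning
  touch : Fin s → Fin N → Bool
  -- Coincidence with X i counts as touching, so the vertices chosen in A are also disjoint from
  -- those chosen in B.
  touch i y = does (y Fin.≟ X i) ∨ rel (X i) y
  touched? : ∀ y → Dec (∃ λ i → touch i y ≡ true)
  touched? y = Fin.any? (λ i → touch i y Bool.≟ true)
  touched : Fin N → Bool
  touched y = does (touched? y)
  -- The term 4 * s pays for the vertex X i itself. The degree is at most 2 * card A / K with K ≥ 8
  -- * s, so 4 * s times it is at most card A.
  share-bound : ∀ i → 4 * (s * card (λ y → A y ∧ touch i y)) ≤ 4 * s + card A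
  share-bound i = begin
    4 * (s * card (λ y → A y ∧ touch i y))           ≤⟨ *-monoʳ-≤ 4 (*-monoʳ-≤ s (≤-trans cover
                                                          (+-monoˡ-≤ (degree rel A (X i)) single))) ⟩
    4 * (s * (1 + degree rel A (X i)))               ≡⟨ expand s (degree rel A (X i)) ⟩
    4 * s + 4 * s * degree rel A (X i)               ≤⟨ +-monoʳ-≤ (4 * s) (*-cancelˡ-≤ 2 (begin
      2 * (4 * s * degree rel A (X i))                 ≡⟨ regroup s (degree rel A (X i)) ⟩
      degree rel A (X i) * (8 * s)                     ≤⟨ *-monoʳ-≤ (degree rel A (X i)) K-large ⟩
      degree rel A (X i) * K                           ≤⟨ sparse (X i) (X∈B i) ⟩
      2 * card A                                       ∎)) ⟩
    4 * s + card A                                   ∎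
    where
    expand : ∀ s g → 4 * (s * (1 + g)) ≡ 4 * s + 4 * s * g
    expand = solve-∀
    regroup : ∀ s g → 2 * (4 * s * g) ≡ g * (8 * s)
    regroup = solve-∀
    is-X : Fin N → Bool
    is-X y = does (y Fin.≟ X i)
    single : card is-X ≤ 1
    single = card-subsingleton is-X λ y y′ p p′ → trans (does-sound (y Fin.≟ X i) p) (sym (does-sound (y′ Fin.≟ X i) p′))
    cover : card (λ y → A y ∧ touch i y) ≤ card is-X + degree rel A (X i)
    cover = ≤-trans (card-mono {P = λ y → A y ∧ touch i y} {Q = λ y → is-X y ∨ (A y ∧ rel (X i) y)} λ y → absorb (A y) (is-X y))
                    (card-∨ is-X (λ y → A y ∧ rel (X i) y))
      where
      absorb : ∀ a b {c} → a ∧ (b ∨ c) ≡ true → b ∨ (a ∧ c) ≡ true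
      absorb true true  _ = refl
      absorb true false p = p
  touched-bound : 4 * card (λ y → A y ∧ touched y) ≤ 4 * s + card A
  touched-bound with 1 ≤? card (λ y → A y ∧ touched y)
  ... | no  none = ≤-trans (*-monoʳ-≤ 4 (s≤s⁻¹ (≰⇒> none))) z≤n
  ... | yes some with cover-pigeonhole (λ y → A y ∧ touched y) (λ i y → A y ∧ touch i y) some
          (λ y p → proj₁ (does-sound (touched? y) (∧-snd {A y} p)) ,
                   ∧-intro (∧-fst p) (proj₂ (does-sound (touched? y) (∧-snd {A y} p))))
  ...   | i , share = ≤-trans (*-monoʳ-≤ 4 share) (share-bound i)
  room : s ≤ card (λ y → A y ∧ not (touched y))
  room = *-cancelˡ-≤ 4 (+-cancelˡ-≤ (4 * s + card A) _ _ (begin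
    4 * s + card A + 4 * s                                  ≤⟨ +-monoˡ-≤ (4 * s) (+-monoˡ-≤ (card A) A-large) ⟩
    card A + card A + 4 * s                                 ≤⟨ +-monoʳ-≤ (card A + card A) (≤-trans A-large (m≤n*m (card A) 2)) ⟩
    card A + card A + 2 * card A                            ≡⟨ four (card A) ⟩
    4 * card A                                              ≤⟨ *-monoʳ-≤ 4 (card-split A touched) ⟩
    4 * (card (λ y → A y ∧ touched y) + free)               ≡⟨ *-distribˡ-+ 4 (card (λ y → A y ∧ touched y)) free ⟩
    4 * card (λ y → A y ∧ touched y) + 4 * free             ≤⟨ +-monoˡ-≤ (4 * free) touched-bound ⟩
    4 * s + card A + 4 * free                               ∎))
    where
    free = card (λ y → A y ∧ not (touched y))
    four : ∀ a → a + a + 2 * a ≡ 4 * a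
    four = solve-∀
  choose : (∃ λ (Y : Fin s → Fin N) → (∀ i j → Y i ≡ Y j → i ≡ j) × (∀ i → A (Y i) ∧ not (touched (Y i)) ≡ true)) →
           ∃₂ λ (X Y : Fin s → Fin N) → SpreadPair X Y × (∀ i → B (X i) ≡ true) × (∀ i j → rel (X i) (Y j) ≡ false)
  choose (Y , Y-inj , Y∈) = X , Y , (X-inj , Y-inj , λ i j eq → untouched j (i , cong (_∨ rel (X i) (Y j))
                                  (does-complete (Y j Fin.≟ X i) (sym eq))))
                              , X∈B
                              , λ i j → Bool.¬-not λ p → untouched j (i , trans (cong (does (Y j Fin.≟ X i) ∨_) p) (Bool.∨-zeroʳ _))
    where
    untouched : ∀ j → ¬ (∃ λ i → touch i (Y j) ≡ true)
    untouched j hit with trans (sym (cong not (does-complete (touched? (Y j)) hit))) (∧-snd {A (Y j)} (Y∈ j))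
    ... | ()

module _ {n d N M} (H : EOGraph n) (degenerate : Degenerate d H) (f : Fin (N * N) → Fin M)
  (s h K₁ K₂ K₃ : ℕ) (n>0 : 1 ≤ n) (s>0 : 1 ≤ s) (d<2^h : d < 2 ^ h) (labels : (n * n) ^ 2 ^ h ≤ M)
  (K₃-large : 8 * s ≤ K₃) (K₂-large : 2 * (K₃ * (n * K₃ ^ d)) ≤ K₂) (K₁-large : 2 * 2 ^ h * K₂ ≤ K₁)
  (N-large : clusterSize n d K₁ (4 * s * n * K₃ ^ d) h ≤ N) (universal : Universal {N} s f) where

  private
    open ≤-Reasoning
    base : ℕ
    base = 4 * s * n * K₃ ^ d
    instance
      n-nonZero : NonZero n
      n-nonZero = >-nonZero n>0
      s-nonZero : NonZero s
      s-nonZero = >-nonZero s>0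
      K₃-nonZero : NonZero K₃
      K₃-nonZero = >-nonZero (≤-trans s>0 (≤-trans (m≤n*m s 8) K₃-large))
      K₃^d-nonZero : NonZero (K₃ ^ d)
      K₃^d-nonZero = m^n≢0 K₃ d
      nK-nonZero : NonZero (n * K₃ ^ d)
      nK-nonZero = m*n≢0 n (K₃ ^ d)
      K₃nK-nonZero : NonZero (K₃ * (n * K₃ ^ d))
      K₃nK-nonZero = m*n≢0 K₃ (n * K₃ ^ d)
      K₂-nonZero : NonZero K₂
      K₂-nonZero = >-nonZero (≤-trans (>-nonZero⁻¹ (2 * (K₃ * (n * K₃ ^ d))) {{m*n≢0 2 (K₃ * (n * K₃ ^ d))}}) K₂-large)
    base-split : base ≡ 4 * s * (n * K₃ ^ d)
    base-split = *-assoc (4 * s) n (K₃ ^ d)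
    base-large : n * K₃ ^ d < base
    base-large = begin-strict
      n * K₃ ^ d                <⟨ m<m*n (n * K₃ ^ d) (4 * s) (≤-trans (s≤s (s≤s z≤n)) (m≤m*n 4 s)) ⟩
      n * K₃ ^ d * (4 * s)      ≡⟨ *-comm (n * K₃ ^ d) (4 * s) ⟩
      4 * s * (n * K₃ ^ d)      ≡⟨ base-split ⟨
      base                      ∎

  -- K₁ governs the red stage, 1/K₂ is the red density between clusters, and K₃ governs the blue
  -- stage. That density must remain useful after passing to subsets smaller by a factor n * K₃^d,
  -- which is why K₂ exceeds K₃ * (n * K₃^d) twofold.
  ramsey-host : RamseyFor H (host f)
  -- The red stage stops at exponent 1. The remaining level has children of length one, so in the
  -- blue stage every edge of H asks for a single value of `f`.
  ramsey-host c = red-stage (clusters H f c degenerate K₁ K₂ base n>0 (>-nonZero⁻¹ K₂) (≤-trans (s≤s z≤n) base-large)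
                     h 1 0 (λ _ → true) (≤-trans N-large (≤-reflexive (sym (card-full N)))) K₁-large)
    where
    red-stage : MonoCopy H (host f) c ⊎ Clusters H f c degenerate K₁ K₂ base n>0 (>-nonZero⁻¹ K₂) (≤-trans (s≤s z≤n) base-large)
                  h 0 (depth 1 h) 1 (λ _ → true) → MonoCopy H (host f) c
    red-stage (inj₁ m) = m
    red-stage (inj₂ clustered) = colour-stage (proper-colouring {d = d} {H = H} degenerate (2 ^ h) d<2^h)
      where
      open Clusters clustered
      colour-stage : (∃ λ (χ : Fin n → Fin (2 ^ h)) → ∀ u v → adj H u v ≡ true → χ u ≢ χ v) → MonoCopy H (host f) c
      colour-stage (χ , proper) = blue-stage (greedy H degenerate K₃ (>-nonZero⁻¹ K₃) blue-child
                                    (childLink-sym H f c false origin 0) (W ∘ χ)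
                                    (λ u → <-≤-trans base-large (W-large (χ u))))
        where
        blue-child : Fin n → Fin n → Fin N → Fin N → Bool
        blue-child = childLink H f c false origin 0
        blue-stage : Embedding H blue-child (W ∘ χ) ⊎ SparsePair d H K₃ blue-child (W ∘ χ) → MonoCopy H (host f) c
        blue-stage (inj₁ e) = embedding⇒mono H f c false origin 0 e
        blue-stage (inj₂ p) = ⊥-elim (contradicts (unlinked-pair any-colour s K₃ A B′ s>0 K₃-large B′-size A-size any-sparse))
          where
          open SparsePair p
          a : ℕ
          a = origin + rank H (label H u v) * (n * n) ^ 0
          red blue any-colour : Fin N → Fin N → Bool
          red  = link H f c true a 0
          blue = link H f c false a 0
          any-colour x y = red x y ∨ blue x y
          heavy : Fin N → Bool
          heavy x = does (card A <? degree red A x * K₃)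
          B′ : Fin N → Bool
          B′ x = B x ∧ not (heavy x)
          A-size : 4 * s ≤ card A
          A-size = *-cancelʳ-≤ _ _ (K₃ ^ d) (begin
            4 * s * K₃ ^ d              ≤⟨ *-monoʳ-≤ (4 * s) (m≤n*m (K₃ ^ d) n) ⟩
            4 * s * (n * K₃ ^ d)        ≡⟨ base-split ⟨
            base                        ≤⟨ W-large (χ v) ⟩
            card (W (χ v))              ≤⟨ A-large ⟩
            card A * K₃ ^ d             ∎)
          swap : ∀ n b k → n * b * k ≡ b * (n * k)
          swap = solve-∀
          B-size : 4 * s ≤ card B
          B-size = *-cancelʳ-≤ _ _ (n * K₃ ^ d) (begin
            4 * s * (n * K₃ ^ d)        ≡⟨ base-split ⟨
            base                        ≤⟨ W-large (χ u) ⟩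
            card (W (χ u))              ≤⟨ B-large ⟩
            n * card B * K₃ ^ d         ≡⟨ swap n (card B) (K₃ ^ d) ⟩
            card B * (n * K₃ ^ d)       ∎)
          red-degree : ∀ X Y x → X ⊑ Y → degree red X x ≤ degree (link H f c true origin 1) Y x
          red-degree X Y x X⊑Y = degree-mono red (link H f c true origin 1) X Y x
            (link-mono H f c true {origin} {1} {a} {0} (child-Sub H f c origin 0 u v) x) X⊑Y
          few-B : card (λ x → B x ∧ heavy x) * K₂ ≤ K₃ * (card B * (n * K₃ ^ d))
          few-B with W-low (χ v) (χ u) (λ eq → proper u v u~v (sym eq))
          -- The bound holds from the side of B: restricting it to A leaves no heavy vertex at all.
          ... | inj₁ low = ≤-trans (*-monoˡ-≤ K₂ (card-mono {P = λ x → B x ∧ heavy x} {Q = λ _ → false} none))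
                                   (≤-trans (≤-reflexive (cong (_* K₂) (trans (sum-const N 0) (*-zeroʳ N)))) z≤n)
            where
            light : ∀ x → B x ≡ true → degree red A x * K₃ ≤ card A
            light x x∈B = *-cancelʳ-≤ _ _ (n * K₃ ^ d) (begin
              degree red A x * K₃ * (n * K₃ ^ d)      ≡⟨ *-assoc (degree red A x) K₃ (n * K₃ ^ d) ⟩
              degree red A x * (K₃ * (n * K₃ ^ d))    ≤⟨ *-monoʳ-≤ (degree red A x) (≤-trans (m≤n*m (K₃ * (n * K₃ ^ d)) 2) K₂-large) ⟩
              degree red A x * K₂                     ≤⟨ *-monoˡ-≤ K₂ (red-degree A (W (χ v)) x A⊑C) ⟩
              degree (link H f c true origin 1) (W (χ v)) x * K₂
                                                      ≤⟨ low x (B⊑C x x∈B) ⟩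
              card (W (χ v))                          ≤⟨ A-large ⟩
              card A * K₃ ^ d                         ≤⟨ *-monoʳ-≤ (card A) (m≤n*m (K₃ ^ d) n) ⟩
              card A * (n * K₃ ^ d)                   ∎)
            none : (λ x → B x ∧ heavy x) ⊑ (λ _ → false)
            none x m = contradiction (does-sound (card A <? degree red A x * K₃) (∧-snd {B x} m)) (≤⇒≯ (light x (∧-fst m)))
          -- The bound holds from the side of A, and Markov transfers it to all but few vertices of
          -- B.
          ... | inj₂ low = few-heavy red (link-sym H f c true a 0) A B K₂ (n * K₃ ^ d) K₃
                             (≤-trans (>-nonZero⁻¹ (4 * s) {{m*n≢0 4 s}}) A-size) λ y y∈A → begin
            degree red B y * K₂                       ≤⟨ *-monoˡ-≤ K₂ (red-degree B (W (χ u)) y B⊑C) ⟩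
            degree (link H f c true origin 1) (W (χ u)) y * K₂
                                                      ≤⟨ low y (A⊑C y y∈A) ⟩
            card (W (χ u))                            ≤⟨ B-large ⟩
            n * card B * K₃ ^ d                       ≡⟨ swap n (card B) (K₃ ^ d) ⟩
            card B * (n * K₃ ^ d)                     ∎
          half : 2 * card (λ x → B x ∧ heavy x) ≤ card B
          half = *-cancelʳ-≤ _ _ (K₃ * (n * K₃ ^ d)) (begin
            2 * t * (K₃ * (n * K₃ ^ d))               ≡⟨ swap 2 t (K₃ * (n * K₃ ^ d)) ⟩
            t * (2 * (K₃ * (n * K₃ ^ d)))             ≤⟨ *-monoʳ-≤ t K₂-large ⟩
            t * K₂                                    ≤⟨ few-B ⟩
            K₃ * (card B * (n * K₃ ^ d))              ≡⟨ exchange K₃ (card B) (n * K₃ ^ d) ⟩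
            card B * (K₃ * (n * K₃ ^ d))              ∎)
            where
            t = card (λ x → B x ∧ heavy x)
            exchange : ∀ k b m → k * (b * m) ≡ b * (k * m)
            exchange = solve-∀
          B′-size : s ≤ card B′
          B′-size = *-cancelˡ-≤ 2 (≤-trans (*-monoˡ-≤ s (s≤s (s≤s (z≤n {2})))) (≤-trans B-size (half-remains B heavy half)))
          any-sparse : ∀ x → B′ x ≡ true → degree any-colour A x * K₃ ≤ 2 * card A
          any-sparse x m = begin
            degree any-colour A x * K₃                        ≤⟨ *-monoˡ-≤ K₃ split ⟩
            (degree red A x + degree blue A x) * K₃           ≡⟨ *-distribʳ-+ K₃ (degree red A x) (degree blue A x) ⟩
            degree red A x * K₃ + degree blue A x * K₃        ≤⟨ +-mono-≤ red-light (<⇒≤ (sparse x (∧-fst m))) ⟩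
            card A + card A                                   ≡⟨ cong (card A +_) (+-identityʳ (card A)) ⟨
            2 * card A                                        ∎
            where
            split : degree any-colour A x ≤ degree red A x + degree blue A x
            split = ≤-trans (card-mono {P = λ y → A y ∧ any-colour x y} {Q = λ y → (A y ∧ red x y) ∨ (A y ∧ blue x y)}
                              λ y q → trans (sym (Bool.∧-distribˡ-∨ (A y) (red x y) (blue x y))) q)
                            (card-∨ (λ y → A y ∧ red x y) (λ y → A y ∧ blue x y))
            red-light : degree red A x * K₃ ≤ card A
            red-light = ≮⇒≥ λ lt → refuted (does-complete (card A <? degree red A x * K₃) lt)
              where
              refuted : heavy x ≡ true → ⊥
              refuted q with trans (sym (cong not q)) (∧-snd {B x} m)
              ... | ()
          -- The search began at 0 with exponent `depth 1 h`, which equals 2^h, so a is one of the M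
          -- values available to `f`.
          a<M : a < M
          a<M = begin-strict
            a                                     <⟨ n<1+n a ⟩
            suc a                                 ≡⟨ +-comm 1 a ⟩
            a + (n * n) ^ 0                       ≤⟨ proj₂ (Sub-trans H f c {0} {depth 1 h} {origin} {1} {a} {0}
                                                       (child-Sub H f c origin 0 u v) inside) ⟩
            (n * n) ^ depth 1 h                   ≡⟨ cong ((n * n) ^_) (suc-injective (depth-sum 1 h)) ⟩
            (n * n) ^ 2 ^ h                       ≤⟨ labels ⟩
            M                                     ∎
          contradicts : (∃₂ λ (X Y : Fin s → Fin N) → SpreadPair X Y × (∀ i → B′ (X i) ≡ true) ×
                          (∀ i j → any-colour (X i) (Y j) ≡ false)) → ⊥
          -- Universality yields an edge between X and Y with value a; whichever colour it has, it
          -- is a link that should not exist.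
          contradicts (X , Y , spread , _ , unlinked) with universal X Y spread (fromℕ< a<M)
          ... | i , j , eq = coloured (col c (X i) (Y j)) refl
            where
            at : toℕ (f (pair (X i) (Y j))) ≡ a
            at = trans (cong toℕ eq) (Fin.toℕ-fromℕ< a<M)
            linked : ∀ b → col c (X i) (Y j) ≡ b → link H f c b a 0 (X i) (Y j) ≡ true
            linked b colour = does-complete (link? H f c b a 0 (X i) (Y j))
              (proj₂ (proj₂ spread) i j , colour , ≤-reflexive (sym at) , ≤-reflexive (trans (cong suc at) (+-comm 1 a)))
            clash : any-colour (X i) (Y j) ≡ true → ⊥
            clash q with trans (sym q) (unlinked i j)
            ... | ()
            coloured : ∀ b → col c (X i) (Y j) ≡ b → ⊥
            coloured true  colour = clash (cong (_∨ blue (X i) (Y j)) (linked true colour))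
            coloured false colour = clash (trans (cong (red (X i) (Y j) ∨_) (linked false colour)) (Bool.∨-zeroʳ (red (X i) (Y j))))

-- Choice of parameters and the numerical bound

n<2^n : ∀ n → n < 2 ^ n
n<2^n zero    = s≤s z≤n
n<2^n (suc n) = begin-strict
  suc n              <⟨ s≤s (n<2^n n) ⟩
  suc (2 ^ n)        ≤⟨ +-monoˡ-≤ (2 ^ n) (m^n>0 2 n) ⟩
  2 ^ n + 2 ^ n      ≡⟨ cong (2 ^ n +_) (+-identityʳ (2 ^ n)) ⟨
  2 ^ suc n          ∎
  where open ≤-Reasoning

^-reflectsʳ-≤ : ∀ x y → 2 ^ x ≤ 2 ^ y → x ≤ y
^-reflectsʳ-≤ x y le = ≮⇒≥ λ lt → <⇒≱ (^-monoʳ-< 2 (s≤s (s≤s z≤n)) lt) le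

-- Both bounds are used: d < 2^(1 + g) provides enough colour classes, and 2^g ≤ d keeps the
-- exponent of the final bound logarithmic.
floor-log : ∀ d → 1 ≤ d → ∃ λ g → 2 ^ g ≤ d × d < 2 ^ suc g
floor-log (suc zero) _ = 0 , s≤s z≤n , s≤s (s≤s z≤n)
floor-log (suc (suc d)) _ with floor-log (suc d) (s≤s z≤n)
... | g , lo , hi with suc (suc d) <? 2 ^ suc g
...   | yes lt = g , m≤n⇒m≤1+n lo , lt
...   | no ¬lt = suc g , ≮⇒≥ ¬lt , <-≤-trans (s≤s hi) (begin
  suc (2 ^ suc g)              ≤⟨ +-monoˡ-≤ (2 ^ suc g) (m^n>0 2 (suc g)) ⟩
  2 ^ suc g + 2 ^ suc g        ≡⟨ cong (2 ^ suc g +_) (+-identityʳ (2 ^ suc g)) ⟨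
  2 ^ suc (suc g)              ∎)
  where open ≤-Reasoning

^-distribʳ-* : ∀ k x y → (x * y) ^ k ≡ x ^ k * y ^ k
^-distribʳ-* zero    x y = refl
^-distribʳ-* (suc k) x y = trans (cong (x * y *_) (^-distribʳ-* k x y)) (interchange x y (x ^ k) (y ^ k))
  where
  interchange : ∀ a b c d → a * b * (c * d) ≡ a * c * (b * d)
  interchange = solve-∀

-- (1 + 1/a)^(1 + a) ≥ 2 beats the number of triples (A , B , label).
few-constraints : ∀ N a r b → 1 ≤ a → N ≤ 2 ^ b → 2 * b + 1 ≤ r →
                  let s = suc a * r in N ^ s * (N ^ s * suc a) * a ^ (s * s) < suc a ^ (s * s)
few-constraints N a r b a>0 N≤ r-large = begin-strict
  N ^ s * (N ^ s * suc a) * a ^ (s * s)       <⟨ *-monoˡ-< (a ^ (s * s)) {{m^n≢0 a (s * s) {{>-nonZero a>0}}}} triples ⟩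
  2 ^ (r * s) * a ^ (s * s)                   ≡⟨ cong (λ z → 2 ^ (r * s) * a ^ z) ss ⟩
  2 ^ (r * s) * a ^ (suc a * (r * s))         ≡⟨ cong (2 ^ (r * s) *_) (^-*-assoc a (suc a) (r * s)) ⟨
  2 ^ (r * s) * (a ^ suc a) ^ (r * s)         ≡⟨ ^-distribʳ-* (r * s) 2 (a ^ suc a) ⟨
  (2 * a ^ suc a) ^ (r * s)                   ≤⟨ ^-monoˡ-≤ (r * s) (double-power a a>0) ⟩
  (suc a ^ suc a) ^ (r * s)                   ≡⟨ ^-*-assoc (suc a) (suc a) (r * s) ⟩
  suc a ^ (suc a * (r * s))                   ≡⟨ cong (suc a ^_) ss ⟨
  suc a ^ (s * s)                             ∎
  where
  open ≤-Reasoning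
  s = suc a * r
  ss : s * s ≡ suc a * (r * s)
  ss = *-assoc (suc a) r s
  r>0 : 1 ≤ r
  r>0 = ≤-trans (m≤n+m 1 (2 * b)) r-large
  N^s≤ : N ^ s ≤ 2 ^ (b * s)
  N^s≤ = ≤-trans (^-monoˡ-≤ s N≤) (≤-reflexive (^-*-assoc 2 b s))
  label< : suc a < 2 ^ s
  label< = <-≤-trans (n<2^n (suc a)) (^-monoʳ-≤ 2 (m≤m*n (suc a) r {{>-nonZero r>0}}))
  collect : ∀ b s → b * s + (b * s + s) ≡ (2 * b + 1) * s
  collect = solve-∀
  -- Each tuple contributes b * s to the exponent of 2, and the label contributes at most s because
  -- 1 + a < 2^s.
  triples : N ^ s * (N ^ s * suc a) < 2 ^ (r * s)
  triples = begin-strict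
    N ^ s * (N ^ s * suc a)                   ≤⟨ *-mono-≤ N^s≤ (*-monoˡ-≤ (suc a) N^s≤) ⟩
    2 ^ (b * s) * (2 ^ (b * s) * suc a)       <⟨ *-monoʳ-< (2 ^ (b * s)) {{m^n≢0 2 (b * s)}}
                                                   (*-monoʳ-< (2 ^ (b * s)) {{m^n≢0 2 (b * s)}} label<) ⟩
    2 ^ (b * s) * (2 ^ (b * s) * 2 ^ s)       ≡⟨ cong (2 ^ (b * s) *_) (^-distribˡ-+-* 2 (b * s) s) ⟨
    2 ^ (b * s) * 2 ^ (b * s + s)             ≡⟨ ^-distribˡ-+-* 2 (b * s) (b * s + s) ⟨
    2 ^ (b * s + (b * s + s))                 ≡⟨ cong (2 ^_) (collect b s) ⟩
    2 ^ ((2 * b + 1) * s)                     ≤⟨ ^-monoʳ-≤ 2 (*-monoˡ-≤ s r-large) ⟩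
    2 ^ (r * s)                               ∎

-- As 2 ≤ n, one round multiplies by 2 * n * K^d ≤ n^(2 + k * d).
clusterSize-bound : ∀ {n} d K k e base₀ → 1 < n → K ≡ n ^ k → base₀ ≤ n ^ e →
                    ∀ h → clusterSize n d K base₀ h ≤ n ^ (h * (2 + k * d) + e)
clusterSize-bound d K k e base₀ n>1 K≡ base≤ zero = base≤
clusterSize-bound {n} d K k e base₀ n>1 refl base≤ (suc h) = begin
  2 * n * (n ^ k) ^ d * clusterSize n d K base₀ h
                                             ≤⟨ *-mono-≤ (*-monoˡ-≤ ((n ^ k) ^ d) (*-monoˡ-≤ n n>1))
                                                         (clusterSize-bound d K k e base₀ n>1 refl base≤ h) ⟩
  n * n * (n ^ k) ^ d * n ^ x                ≡⟨ cong (λ z → n * n * z * n ^ x) (^-*-assoc n k d) ⟩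
  n * n * n ^ (k * d) * n ^ x                ≡⟨ cong (_* n ^ x) (*-assoc n n (n ^ (k * d))) ⟩
  n ^ (2 + k * d) * n ^ x                    ≡⟨ ^-distribˡ-+-* n (2 + k * d) x ⟨
  n ^ (2 + k * d + x)                        ≡⟨ cong (n ^_) (+-assoc (2 + k * d) (h * (2 + k * d)) e) ⟨
  n ^ (suc h * (2 + k * d) + e)              ∎
  where
  open ≤-Reasoning
  x = h * (2 + k * d) + e

-- Naming the difference turns a polynomial inequality into an identity for the ring solver; with d
-- = 1 + e the differences have natural coefficients.
≤-by : ∀ {x y} z → x + z ≡ y → x ≤ y
≤-by {x} z refl = m≤m+n x z

trivial-host : ∀ {n} → n ≤ 1 → (H : EOGraph n) → RamseyFor H H
trivial-host {n} n≤1 H c = record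
  { φ      = λ u → u
  ; φ-inj  = λ eq → eq
  ; φ-edge = λ _ _ e → e
  ; φ-ord  = λ _ _ _ _ _ _ lt → lt
  ; φ-ord⁻ = λ _ _ _ _ _ _ lt → lt
  } , true , λ u v e → contradiction (trans (sym e) (trans (cong (adj H u) (sym (only u v n≤1))) (adj-irr H u))) λ ()
  where
  only : ∀ {n} (u v : Fin n) → n ≤ 1 → u ≡ v
  only {suc zero} zero zero _ = refl
  only {suc (suc _)} _ _ (s≤s ())

module _ (n : ℕ) (n>1 : 1 < n) where

  private
    open ≤-Reasoning
    instance
      n-nonZero : NonZero n
      n-nonZero = >-nonZero (<-trans (s≤s z≤n) n>1)

    2^≤n^ : ∀ k → 2 ^ k ≤ n ^ k
    2^≤n^ k = ^-monoˡ-≤ k n>1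

    n^-mono : ∀ x y → x ≤ y → n ^ x ≤ n ^ y
    n^-mono _ _ = ^-monoʳ-≤ n

  module _ (e g : ℕ) (lo : 2 ^ g ≤ suc e) (hi : suc e < 2 ^ suc g) where

    private
      -- As 2^h ≤ 2 * d, M accommodates (n * n)^(2^h) labels. The exponents come from 3 + 17d ≤ 20d
      -- for K₃, 2 + 20d + 20d² ≤ 42d² for K₂ and 2 + d + 42d² ≤ 45d² for K₁; all three are
      -- equalities at d = 1.
      d h M r s K₁ K₂ K₃ : ℕ
      d  = suc e
      h  = suc g
      M  = n ^ (4 * d)
      r  = n ^ (13 * d)
      s  = M * r
      K₃ = n ^ (20 * d)
      K₂ = n ^ (42 * (d * d))
      K₁ = n ^ (45 * (d * d))

      s≡ : s ≡ n ^ (17 * d)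
      s≡ = trans (sym (^-distribˡ-+-* n (4 * d) (13 * d))) (cong (n ^_) (add d))
        where
        add : ∀ d → 4 * d + 13 * d ≡ 17 * d
        add = solve-∀

      K₃^d≡ : K₃ ^ d ≡ n ^ (20 * (d * d))
      K₃^d≡ = trans (^-*-assoc n (20 * d) d) (cong (n ^_) (*-assoc 20 d d))

      d<n^d : d < n ^ d
      d<n^d = <-≤-trans (n<2^n d) (2^≤n^ d)

      2^h≤2d : 2 ^ h ≤ 2 * d
      2^h≤2d = *-monoʳ-≤ 2 lo

      h≤d : h ≤ d
      h≤d = <-≤-trans (n<2^n g) lo

      labels : (n * n) ^ 2 ^ h ≤ M
      labels = begin
        (n * n) ^ 2 ^ h        ≡⟨ cong (λ z → (n * z) ^ 2 ^ h) (*-identityʳ n) ⟨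
        (n ^ 2) ^ 2 ^ h        ≡⟨ ^-*-assoc n 2 (2 ^ h) ⟩
        n ^ (2 * 2 ^ h)        ≤⟨ n^-mono (2 * 2 ^ h) (4 * d) (≤-trans (*-monoʳ-≤ 2 2^h≤2d) (≤-reflexive (sym (*-assoc 2 2 d)))) ⟩
        n ^ (4 * d)            ∎

      K₃-large : 8 * s ≤ K₃
      K₃-large = begin
        8 * s                  ≤⟨ *-mono-≤ (2^≤n^ 3) (≤-reflexive s≡) ⟩
        n ^ 3 * n ^ (17 * d)   ≡⟨ ^-distribˡ-+-* n 3 (17 * d) ⟨
        n ^ (3 + 17 * d)       ≤⟨ n^-mono (3 + 17 * d) (20 * d) (≤-by (3 * e) (poly e)) ⟩
        n ^ (20 * d)           ∎
        where
        poly : ∀ e → 3 + 17 * suc e + 3 * e ≡ 20 * suc e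
        poly = solve-∀

      K₂-large : 2 * (K₃ * (n * K₃ ^ d)) ≤ K₂
      K₂-large = begin
        2 * (K₃ * (n * K₃ ^ d))                              ≤⟨ *-monoˡ-≤ (K₃ * (n * K₃ ^ d)) n>1 ⟩
        n * (K₃ * (n * K₃ ^ d))                              ≡⟨ cong (λ z → n * (K₃ * (n * z))) K₃^d≡ ⟩
        n * (n ^ (20 * d) * n ^ (1 + 20 * (d * d)))          ≡⟨ cong (n *_) (^-distribˡ-+-* n (20 * d) (1 + 20 * (d * d))) ⟨
        n ^ (1 + (20 * d + (1 + 20 * (d * d))))              ≤⟨ n^-mono (1 + (20 * d + (1 + 20 * (d * d)))) (42 * (d * d))
                                                                  (≤-by (22 * (e * e) + 24 * e) (poly e)) ⟩
        n ^ (42 * (d * d))                                   ∎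
        where
        poly : ∀ e → 1 + (20 * suc e + (1 + 20 * (suc e * suc e))) + (22 * (e * e) + 24 * e) ≡ 42 * (suc e * suc e)
        poly = solve-∀

      K₁-large : 2 * 2 ^ h * K₂ ≤ K₁
      K₁-large = begin
        2 * 2 ^ h * K₂                                       ≤⟨ *-monoˡ-≤ K₂ (*-monoʳ-≤ 2 2^h≤2d) ⟩
        2 * (2 * d) * K₂                                     ≤⟨ *-monoˡ-≤ K₂ (*-mono-≤ n>1 (*-mono-≤ n>1 (<⇒≤ d<n^d))) ⟩
        n ^ (2 + d) * n ^ (42 * (d * d))                     ≡⟨ ^-distribˡ-+-* n (2 + d) (42 * (d * d)) ⟨
        n ^ (2 + d + 42 * (d * d))                           ≤⟨ n^-mono (2 + d + 42 * (d * d)) (45 * (d * d))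
                                                                  (≤-by (3 * (e * e) + 5 * e) (poly e)) ⟩
        n ^ (45 * (d * d))                                   ∎
        where
        poly : ∀ e → 2 + suc e + 42 * (suc e * suc e) + (3 * (e * e) + 5 * e) ≡ 45 * (suc e * suc e)
        poly = solve-∀

      base≤ : 4 * s * n * K₃ ^ d ≤ n ^ (40 * (d * d))
      base≤ = begin
        4 * s * n * K₃ ^ d                                   ≡⟨ cong₂ (λ x y → 4 * x * n * y) s≡ K₃^d≡ ⟩
        4 * n ^ (17 * d) * n * n ^ (20 * (d * d))            ≤⟨ *-monoˡ-≤ (n ^ (20 * (d * d)))
                                                                  (*-monoˡ-≤ n (*-monoˡ-≤ (n ^ (17 * d)) (2^≤n^ 2))) ⟩
        n ^ 2 * n ^ (17 * d) * n * n ^ (20 * (d * d))        ≡⟨ *-assoc (n ^ 2 * n ^ (17 * d)) n (n ^ (20 * (d * d))) ⟩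
        n ^ 2 * n ^ (17 * d) * n ^ (1 + 20 * (d * d))        ≡⟨ cong (_* n ^ (1 + 20 * (d * d))) (^-distribˡ-+-* n 2 (17 * d)) ⟨
        n ^ (2 + 17 * d) * n ^ (1 + 20 * (d * d))            ≡⟨ ^-distribˡ-+-* n (2 + 17 * d) (1 + 20 * (d * d)) ⟨
        n ^ (2 + 17 * d + (1 + 20 * (d * d)))                ≤⟨ n^-mono (2 + 17 * d + (1 + 20 * (d * d))) (40 * (d * d))
                                                                  (≤-by (20 * (e * e) + 23 * e) (poly e)) ⟩
        n ^ (40 * (d * d))                                   ∎
        where
        poly : ∀ e → 2 + 17 * suc e + (1 + 20 * (suc e * suc e)) + (20 * (e * e) + 23 * e) ≡ 40 * (suc e * suc e)
        poly = solve-∀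

    -- Leaves room for the exponent h * (2 + 45d³) + 40d² that the clusters require.
    order : ℕ
    order = n ^ (100 * (d * d * d * h))

    private
      order-large : clusterSize n d K₁ (4 * s * n * K₃ ^ d) h ≤ order
      order-large = ≤-trans (clusterSize-bound d K₁ (45 * (d * d)) (40 * (d * d)) (4 * s * n * K₃ ^ d) n>1 refl base≤ h)
        (n^-mono (h * (2 + 45 * (d * d) * d) + 40 * (d * d)) (100 * (d * d * d * h))
          (≤-by (g * (53 + 165 * e + 165 * (e * e) + 55 * (e * e * e)) +
                 (13 + 85 * e + 125 * (e * e) + 55 * (e * e * e))) (poly e g)))
        where
        poly : ∀ e g → suc g * (2 + 45 * (suc e * suc e) * suc e) + 40 * (suc e * suc e) +
                 (g * (53 + 165 * e + 165 * (e * e) + 55 * (e * e * e)) + (13 + 85 * e + 125 * (e * e) + 55 * (e * e * e)))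
               ≡ 100 * (suc e * suc e * suc e * suc g)
        poly = solve-∀

      exponent : ℕ
      exponent = 100 * (d * d * d * h)

      order≤ : order ≤ 2 ^ (n * exponent)
      order≤ = ≤-trans (^-monoˡ-≤ exponent (<⇒≤ (n<2^n n))) (≤-reflexive (^-*-assoc 2 n exponent))

      -- There is no circularity, although s enters the size of the host: r has to beat only the
      -- logarithm of `order`, which is polynomial in n and d.
      r-large : 2 * (n * exponent) + 1 ≤ r
      r-large = begin
        2 * (n * exponent) + 1                          ≤⟨ +-monoˡ-≤ 1 (*-monoʳ-≤ 2 (*-monoʳ-≤ n
                                                            (*-monoʳ-≤ 100 (*-monoʳ-≤ (d * d * d) h≤d)))) ⟩
        2 * (n * (100 * (d * d * d * d))) + 1           ≤⟨ +-monoʳ-≤ _ (*-mono-≤ {1} {n} (<⇒≤ n>1)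
                                                            (*-mono-≤ {1} {d * d * d} {1} {d} (s≤s z≤n) (s≤s z≤n))) ⟩
        2 * (n * (100 * (d * d * d * d))) + n * (d * d * d * d)
                                                        ≤⟨ ≤-by (55 * (n * (d * d * d * d))) (collect n (d * d * d * d)) ⟩
        256 * (n * (d * d * d * d))                     ≤⟨ *-mono-≤ (2^≤n^ 8) (*-monoʳ-≤ n (*-mono-≤ (*-mono-≤ (*-mono-≤ d≤ d≤) d≤) d≤)) ⟩
        n ^ 8 * (n * (n ^ d * n ^ d * n ^ d * n ^ d))   ≡⟨ cong (λ z → n ^ 8 * (n * z)) fourth ⟩
        n ^ 8 * n ^ (1 + (d + d + d + d))               ≡⟨ ^-distribˡ-+-* n 8 (1 + (d + d + d + d)) ⟨
        n ^ (8 + (1 + (d + d + d + d)))                 ≤⟨ n^-mono (8 + (1 + (d + d + d + d))) (13 * d) (≤-by (9 * e) (poly e)) ⟩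
        n ^ (13 * d)                                    ∎
        where
        d≤ : d ≤ n ^ d
        d≤ = <⇒≤ d<n^d
        collect : ∀ n x → 2 * (n * (100 * x)) + n * x + 55 * (n * x) ≡ 256 * (n * x)
        collect = solve-∀
        fourth : n ^ d * n ^ d * n ^ d * n ^ d ≡ n ^ (d + d + d + d)
        fourth = sym (trans (^-distribˡ-+-* n (d + d + d) d) (cong (_* n ^ d)
                   (trans (^-distribˡ-+-* n (d + d) d) (cong (_* n ^ d) (^-distribˡ-+-* n d d)))))
        poly : ∀ e → 8 + (1 + (suc e + suc e + suc e + suc e)) + 9 * e ≡ 13 * suc e
        poly = solve-∀

      universal : ∃ λ (f : Fin (order * order) → Fin M) → Universal {order} s f
      universal = by-predecessor M refl M>1
        where
        M>1 : 2 ≤ M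
        M>1 = ≤-trans n>1 (≤-trans (≤-reflexive (sym (^-identityʳ n))) (n^-mono 1 (4 * d) (s≤s z≤n)))
        -- The number of labels is needed as a successor, so M is generalised to m before splitting;
        -- M ≥ 2 makes the predecessor positive.
        by-predecessor : ∀ m → m ≡ M → 2 ≤ m → ∃ λ (f : Fin (order * order) → Fin m) → Universal {order} (m * r) f
        by-predecessor (suc a) _ (s≤s a>0) = universal-labelling order (suc a * r) a
          (few-constraints order a r (n * exponent) a>0 order≤ r-large)

    witness : (H : EOGraph n) → Degenerate d H → RamseyWitness H order
    witness H degenerate = host (proj₁ universal) ,
      ramsey-host H degenerate (proj₁ universal) s h K₁ K₂ K₃ (>-nonZero⁻¹ n) s>0 hi labels
        K₃-large K₂-large K₁-large order-large (proj₂ universal)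
      where
      s>0 : 1 ≤ s
      s>0 = subst (1 ≤_) (sym s≡) (m^n>0 n (17 * d))

    -- Since 2 ≤ d + 1 and 2^g ≤ d + 1, the hypothesis gives q ≤ p and g * q ≤ p. Hence h * q ≤ 2 *
    -- p, and the exponent is at most 200 * d³ * p.
    bounded : BoundedByPowLog order n (600 * d ^ 3) (d + 1)
    bounded p q q>0 le = begin
      order ^ q                                ≡⟨ ^-*-assoc n (100 * (d * d * d * h)) q ⟩
      n ^ (100 * (d * d * d * h) * q)          ≤⟨ n^-mono (100 * (d * d * d * h) * q) (600 * d ^ 3 * p) exponent≤ ⟩
      n ^ (600 * d ^ 3 * p)                    ∎
      where
      q≤p : q ≤ p
      q≤p = ^-reflectsʳ-≤ q p (≤-trans (^-monoˡ-≤ q (≤-trans (s≤s (s≤s z≤n)) (≤-reflexive (+-comm 1 d)))) le)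
      gq≤p : g * q ≤ p
      gq≤p = ^-reflectsʳ-≤ (g * q) p (begin
        2 ^ (g * q)      ≡⟨ ^-*-assoc 2 g q ⟨
        (2 ^ g) ^ q      ≤⟨ ^-monoˡ-≤ q (≤-trans lo (m≤m+n d 1)) ⟩
        (d + 1) ^ q      ≤⟨ le ⟩
        2 ^ p            ∎)
      regroup : ∀ d h q → 100 * (d * d * d * h) * q ≡ 100 * (d * d * d) * (h * q)
      regroup = solve-∀
      enlarge : ∀ d p → 100 * (d * d * d) * (p + p) + 400 * (d * d * d) * p ≡ 600 * (d * (d * (d * 1))) * p
      enlarge = solve-∀
      exponent≤ : 100 * (d * d * d * h) * q ≤ 600 * d ^ 3 * p
      exponent≤ = begin
        100 * (d * d * d * h) * q        ≡⟨ regroup d h q ⟩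
        100 * (d * d * d) * (h * q)      ≤⟨ *-monoʳ-≤ (100 * (d * d * d)) (+-mono-≤ q≤p gq≤p) ⟩
        100 * (d * d * d) * (p + p)      ≤⟨ ≤-by (400 * (d * d * d) * p) (enlarge d p) ⟩
        600 * d ^ 3 * p                  ∎

theorem4 : (d n : ℕ) → 1 ≤ d → (H : EOGraph n) → Degenerate d H →
    ∃ λ N → RamseyWitness H N × BoundedByPowLog N n (600 * d ^ 3) (d + 1)
-- The parameters are powers of n with 2 ≤ n. Smaller graphs have no edges and are their own hosts;
-- for n = 0 the bound holds because q ≥ 1 makes 0^q vanish.
theorem4 (suc e) zero _ H _ = 0 , (H , trivial-host z≤n H) , λ { p (suc q) _ _ → z≤n }
theorem4 (suc e) (suc zero) _ H _ = 1 , (H , trivial-host (s≤s z≤n) H) ,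
  λ p q _ _ → ≤-reflexive (trans (^-zeroˡ q) (sym (^-zeroˡ (600 * suc e ^ 3 * p))))
theorem4 (suc e) n@(suc (suc _)) d>0 H degenerate with floor-log (suc e) d>0
... | g , lo , hi = order n n>1 e g lo hi , witness n n>1 e g lo hi H degenerate , bounded n n>1 e g lo hi
  where
  n>1 : 1 < n
  n>1 = s≤s (s≤s z≤n)
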